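{- Let $G$ be a finite, simple, connected $3$-$\gamma_{c}$-critical graph such that $G \notin \mathcal{G}_{2}(3,3)$. Then for every $q \in \{1,2\}$, $\alpha(G) = \kappa(G) + q$ if and only if $\alpha(G) = \delta(G) + q$.
   Context: All graphs are finite, simple and connected. A set $D \subseteq V(G)$ is a connected dominating set of $G$ if every vertex of $G$ is in $D$ or adjacent to a vertex of $D$, and $G[D]$ is connected; $\gamma_{c}(G)$ is the minimum size of such a set. For non-adjacent $u,v$, $G+uv$ is $G$ with edge $uv$ added. $G$ is $3$-$\gamma_{c}$-critical if $\gamma_{c}(G)=3$ and $\gamma_{c}(G+uv)<3$ for every pair of non-adjacent vertices $u,v$. $\alpha(G)$ is the independence number, $\delta(G)$ the minimum degree, $\kappa(G)$ the connectivity (minimum size of a vertex set whose removal disconnects $G$). The class $\mathcal{G}_{2}(3,3)$: take integers $j_1, j_2 \geq 3$, pairwise disjoint vertex sets $J_1, J_2$ with $|J_1| = j_1$, $|J_2| = j_2$, two distinct vertices $u_1, u_2 \in J_2$, and three further vertices $w, w_1, v_1$. Form the graph on $J_1 \cup J_2 \cup \{w, w_1, v_1\}$ whose edges are exactly: all edges inside $J_1$, all edges inside $J_2$, $v_1$ joined to every vertex of $J_1$, $w_1$ joined to every vertex of $J_1 \cup (J_2 \setminus \{u_1\}) \cup \{w\}$, and $w$ joined to every vertex of $J_1 \cup (J_2 \setminus \{u_2\}) \cup \{w_1\}$. $\mathcal{G}_{2}(3,3)$ is the class of all graphs (up to isomorphism) obtained this way. -}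

module Defs where

open import Data.Nat using (ℕ; _≤_; _<_; _∸_)
open import Data.Bool using (Bool; true; false; _∨_; _∧_; not)
open import Data.Fin using (Fin; _≟_)
open import Data.Fin.Subset using (Subset; _∈_; _∉_; ∁; ∣_∣)
open import Data.Vec using (tabulate)
open import Data.Product using (Σ; ∃; _×_)
open import Data.Sum using (_⊎_)
open import Relation.Nullary using (¬_; ⌊_⌋)
open import Relation.Binary.PropositionalEquality using (_≡_; _≢_)
open import Function.Bundles using (_⇔_)

Graph : ℕ → Set
Graph n = Fin n → Fin n → Bool

module _ {n : ℕ} (G : Graph n) where

  Adj : Fin n → Fin n → Set
  Adj x y = G x y ≡ true

  IsSimple : Set
  IsSimple = (∀ x y → G x y ≡ G y x) × (∀ x → G x x ≡ false)

  data WalkIn (S : Subset n) : Fin n → Fin n → Set where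
    here : ∀ {u} → WalkIn S u u
    step : ∀ {u v w} → Adj u v → v ∈ S → WalkIn S v w → WalkIn S u w

  InducedConnected : Subset n → Set
  InducedConnected S = ∀ u v → u ∈ S → v ∈ S → WalkIn S u v

  Connected : Set
  Connected = (1 ≤ n) × (∀ u v → WalkIn (tabulate (λ _ → true)) u v)

  Dominating : Subset n → Set
  Dominating D = ∀ v → v ∈ D ⊎ (∃ λ u → u ∈ D × Adj u v)

  IsCDS : Subset n → Set
  IsCDS D = Dominating D × InducedConnected D

  GammaC : ℕ → Set
  GammaC k = (∃ λ D → IsCDS D × ∣ D ∣ ≡ k) × (∀ D → IsCDS D → k ≤ ∣ D ∣)

  Independent : Subset n → Set
  Independent S = ∀ x y → x ∈ S → y ∈ S → G x y ≡ false

  Alpha : ℕ → Set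
  Alpha a = (∃ λ S → Independent S × ∣ S ∣ ≡ a) × (∀ S → Independent S → ∣ S ∣ ≤ a)

  degree : Fin n → ℕ
  degree v = ∣ tabulate (G v) ∣

  Delta : ℕ → Set
  Delta d = (∃ λ v → degree v ≡ d) × (∀ v → d ≤ degree v)

  Separating : Subset n → Set
  Separating S = ∃ λ u → ∃ λ v → u ∉ S × v ∉ S × ¬ WalkIn (∁ S) u v

  -- κ(G) = k  (minimum size of a separating set; n - 1 if none exists, i.e. G complete)
  Kappa : ℕ → Set
  Kappa k = ((∃ λ S → Separating S × ∣ S ∣ ≡ k) × (∀ S → Separating S → k ≤ ∣ S ∣))
          ⊎ ((∀ S → ¬ Separating S) × k ≡ n ∸ 1)

addEdge : ∀ {n} → Graph n → Fin n → Fin n → Graph n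
addEdge G u v x y = G x y ∨ (⌊ x ≟ u ⌋ ∧ ⌊ y ≟ v ⌋) ∨ (⌊ x ≟ v ⌋ ∧ ⌊ y ≟ u ⌋)

Critical3 : ∀ {n} → Graph n → Set
Critical3 {n} G = GammaC G 3 ×
  (∀ u v → u ≢ v → G u v ≡ false → ∃ λ k → k < 3 × GammaC (addEdge G u v) k)

-- The class 𝒢₂(3,3), up to isomorphism: the vertices of G are labelled by roles
-- (J₁, J₂, w, w₁, v₁) so that adjacency is exactly the prescribed one.
data Role : Set where
  rJ1 rJ2 rW rW1 rV1 : Role

sameRole : Role → Role → Bool
sameRole rJ1 rJ1 = true
sameRole rJ2 rJ2 = true
sameRole rW rW = true
sameRole rW1 rW1 = true
sameRole rV1 rV1 = true
sameRole _ _ = false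

-- one direction of the prescribed edge relation (x,y distinct); symmetrised below
Spec : ∀ {n} → (Fin n → Role) → Fin n → Fin n → Fin n → Fin n → Set
Spec role u1 u2 x y =
     (role x ≡ rJ1 × role y ≡ rJ1)
  ⊎ (role x ≡ rJ2 × role y ≡ rJ2)
  ⊎ (role x ≡ rV1 × role y ≡ rJ1)
  ⊎ (role x ≡ rW1 × role y ≡ rJ1)
  ⊎ (role x ≡ rW1 × role y ≡ rJ2 × y ≢ u1)
  ⊎ (role x ≡ rW1 × role y ≡ rW)
  ⊎ (role x ≡ rW × role y ≡ rJ1)
  ⊎ (role x ≡ rW × role y ≡ rJ2 × y ≢ u2)

InG233 : ∀ {n} → Graph n → Set
InG233 {n} G = ∃ λ (role : Fin n → Role) → ∃ λ u1 → ∃ λ u2 →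
    3 ≤ ∣ tabulate (λ x → sameRole (role x) rJ1) ∣
  × 3 ≤ ∣ tabulate (λ x → sameRole (role x) rJ2) ∣
  × ∣ tabulate (λ x → sameRole (role x) rW) ∣ ≡ 1
  × ∣ tabulate (λ x → sameRole (role x) rW1) ∣ ≡ 1
  × ∣ tabulate (λ x → sameRole (role x) rV1) ∣ ≡ 1
  × role u1 ≡ rJ2 × role u2 ≡ rJ2 × u1 ≢ u2
  × (∀ x y → x ≢ y → (G x y ≡ true ⇔ (Spec role u1 u2 x y ⊎ Spec role u1 u2 y x)))

{-# OPTIONS --safe #-}
module Submission where

-- If {u, v, t} is independent, criticality of G + uv gives, up to exchanging u and v, an edge uw such
-- that {u, w} dominates exactly V ∖ {v}: an arc u → v with witness w. Let κ < δ, κ < α, and let S be a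
-- minimum cut. As no vertex has all its neighbours in S, every arc has its tail or its witness in S.
-- Distinct heads in an independent set I have distinct witnesses, each missing exactly one member of I,
-- so for |I| = |S| + 1 ≥ 3 a counting argument determines S from I, up to one member r of I outside S.
-- Exchanging members of I and applying this again leaves only |S| = 2 with one member of I in S, which
-- is the class 𝒢₂(3,3); a cut vertex is impossible. Hence κ < α forces κ = δ outside the class, and
-- with κ ≤ δ both directions follow.

open import Defs
open import Data.Bool using (Bool; true; false)
open import Data.Bool.Properties using (¬-not) renaming (_≟_ to _≟ᵇ_)
open import Data.Empty using (⊥; ⊥-elim)
open import Data.Fin using (Fin; zero; suc; _≟_)
open import Data.Fin.Patterns using (0F; 1F; 2F)
open import Data.Fin.Properties using (any?; all?; suc-injective)
open import Data.Fin.Subset using (Subset; _∈_; _∉_; _⊆_; ∁; ∣_∣; _-_; _∪_; ⁅_⁆)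
open import Data.Fin.Subset.Properties
open import Data.Nat using (s≤s⁻¹; ℕ; zero; suc; _+_; _≤_; _<_; z≤n; s≤s)
open import Data.Nat.Properties using (≤-trans; ≤-refl; ≤-reflexive; ≤-antisym; <⇒≱; +-comm; +-mono-≤; +-monoʳ-≤; n≤1+n; +-suc; m≤n⇒m<n∨m≡n; ≤-<-trans; <-≤-trans; +-monoˡ-≤; m<m+n)
open import Data.Product using (∃; _×_; _,_; proj₁; proj₂)
open import Data.Sum as Sum using (_⊎_; inj₁; inj₂; [_,_]′)
open import Data.Vec using (tabulate; []; _∷_)
open import Data.Vec.Properties using (lookup∘tabulate; []=⇒lookup; lookup⇒[]=)
open import Function using (_∘_; id; case_of_)
open import Function.Definitions using (Injective)
open import Function.Bundles using (_⇔_; mk⇔)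
open import Relation.Binary.PropositionalEquality using (_≡_; _≢_; refl; sym; trans; cong; subst; ≢-sym)
open import Relation.Nullary using (¬_; Dec; yes; no)
open import Relation.Nullary.Decidable using (does; does-⇔; dec-true; dec-false; ¬?; _×-dec_; _⊎-dec_; _→-dec_; decidable-stable; ¬¬-excluded-middle)

-- Criticality leaves a further option for a non-adjacent pair: the two vertices may dominate `G` by
-- themselves. A third vertex independent of both rules this out, which is why every argument runs
-- inside an independent triple or a larger family, and why a cut vertex, whose families would have
-- two members only, is treated apart. The count behind the determination of `S`: a member of `I`
-- that lies in `S`, or is the head of an arc with tail outside `S`, owns a private vertex of `S`,
-- itself or the witness. There are more members than vertices of `S`, so some `r` owns none. Arcs
-- between `r` and members outside `S` must then start at `r`, the other members own one vertex
-- each, and these use up `S`. Contradictions arise by running through this list of all possible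
-- witnesses in `S`. The list says nothing about vertices outside `I` and `S`; they are reached by
-- putting them into a new family and counting again.

-- Counting in finite subsets

injection⇒≤∣p∣ : ∀ {m n} (p : Subset n) (e : Fin m → Fin n) → Injective _≡_ _≡_ e → (∀ i → e i ∈ p) → m ≤ ∣ p ∣
injection⇒≤∣p∣ {zero} p e inj e∈p = z≤n
injection⇒≤∣p∣ {suc m} p e inj e∈p =
  ≤-<-trans
    (injection⇒≤∣p∣ (p - e 0F) (e ∘ suc) (suc-injective ∘ inj)
      (λ i → x∈p∧x≢y⇒x∈p-y (e∈p (suc i)) (λ eq → case inj eq of λ ())))
    (x∈p⇒∣p-x∣<∣p∣ (e∈p 0F))

enumerate : ∀ {n} (p : Subset n) m → m ≤ ∣ p ∣ → ∃ λ (e : Fin m → Fin n) → Injective _≡_ _≡_ e × (∀ i → e i ∈ p)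
enumerate p zero _ = (λ ()) , (λ {i} → case i of λ ()) , λ ()
enumerate (false ∷ p) (suc m) le with enumerate p (suc m) le
... | e , inj , e∈p = suc ∘ e , inj ∘ suc-injective , there ∘ e∈p
  where open import Data.Vec using (there)
enumerate {suc n} (true ∷ p) (suc m) (s≤s le) with enumerate p m le
... | e , inj , e∈p = e⁺ , inj⁺ , e⁺∈p
  where
  open import Data.Vec using (here; there)
  e⁺ : Fin (suc m) → Fin (suc n)
  e⁺ zero = zero
  e⁺ (suc i) = suc (e i)
  inj⁺ : Injective _≡_ _≡_ e⁺
  inj⁺ {zero} {zero} _ = refl
  inj⁺ {suc i} {suc j} eq = cong suc (inj (suc-injective eq))
  e⁺∈p : ∀ i → e⁺ i ∈ true ∷ p
  e⁺∈p zero = here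
  e⁺∈p (suc i) = there (e∈p i)

triple : ∀ {n} → Fin n → Fin n → Fin n → Fin 3 → Fin n
triple x y z 0F = x
triple x y z 1F = y
triple x y z 2F = z

triple-injective : ∀ {n} {x y z : Fin n} → x ≢ y → x ≢ z → y ≢ z → Injective _≡_ _≡_ (triple x y z)
triple-injective x≢y x≢z y≢z {0F} {0F} _ = refl
triple-injective x≢y x≢z y≢z {0F} {1F} eq = ⊥-elim (x≢y eq)
triple-injective x≢y x≢z y≢z {0F} {2F} eq = ⊥-elim (x≢z eq)
triple-injective x≢y x≢z y≢z {1F} {0F} eq = ⊥-elim (x≢y (sym eq))
triple-injective x≢y x≢z y≢z {1F} {1F} _ = refl
triple-injective x≢y x≢z y≢z {1F} {2F} eq = ⊥-elim (y≢z eq)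
triple-injective x≢y x≢z y≢z {2F} {0F} eq = ⊥-elim (x≢z (sym eq))
triple-injective x≢y x≢z y≢z {2F} {1F} eq = ⊥-elim (y≢z (sym eq))
triple-injective x≢y x≢z y≢z {2F} {2F} _ = refl

∣p∪q∣≤∣p∣+∣q∣ : ∀ {n} (p q : Subset n) → ∣ p ∪ q ∣ ≤ ∣ p ∣ + ∣ q ∣
∣p∪q∣≤∣p∣+∣q∣ [] [] = z≤n
∣p∪q∣≤∣p∣+∣q∣ (true ∷ p) (true ∷ q) =
  s≤s (≤-trans (∣p∪q∣≤∣p∣+∣q∣ p q) (+-monoʳ-≤ ∣ p ∣ (n≤1+n ∣ q ∣)))
∣p∪q∣≤∣p∣+∣q∣ (true ∷ p) (false ∷ q) = s≤s (∣p∪q∣≤∣p∣+∣q∣ p q)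
∣p∪q∣≤∣p∣+∣q∣ (false ∷ p) (true ∷ q) =
  subst (suc ∣ p ∪ q ∣ ≤_) (sym (+-suc ∣ p ∣ ∣ q ∣)) (s≤s (∣p∪q∣≤∣p∣+∣q∣ p q))
∣p∪q∣≤∣p∣+∣q∣ (false ∷ p) (false ∷ q) = ∣p∪q∣≤∣p∣+∣q∣ p q

∣⁅x⁆∪⁅y⁆∣≤2 : ∀ {n} (x y : Fin n) → ∣ ⁅ x ⁆ ∪ ⁅ y ⁆ ∣ ≤ 2
∣⁅x⁆∪⁅y⁆∣≤2 x y = ≤-trans (∣p∪q∣≤∣p∣+∣q∣ ⁅ x ⁆ ⁅ y ⁆)
  (+-mono-≤ (≤-reflexive (∣⁅x⁆∣≡1 x)) (≤-reflexive (∣⁅x⁆∣≡1 y)))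

-- Supplies the third member of a family that is needed to orient a pair; `i` and `j` may coincide.
another : ∀ {m} → 2 ≤ m → (i j : Fin (suc m)) → ∃ λ l → l ≢ i × l ≢ j
another {m} 2≤m i j with any? (λ l → ¬? (l ≟ i) ×-dec ¬? (l ≟ j))
... | yes found = found
... | no none = ⊥-elim (<⇒≱ (s≤s 2≤m) (≤-trans (injection⇒≤∣p∣ (⁅ i ⁆ ∪ ⁅ j ⁆) id id cover) (∣⁅x⁆∪⁅y⁆∣≤2 i j)))
  where
  cover : ∀ l → l ∈ ⁅ i ⁆ ∪ ⁅ j ⁆
  cover l with l ≟ i | l ≟ j
  ... | yes refl | _ = x∈p∪q⁺ (inj₁ (x∈⁅x⁆ l))
  ... | no _ | yes refl = x∈p∪q⁺ (inj₂ (x∈⁅x⁆ l))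
  ... | no l≢i | no l≢j = ⊥-elim (none (l , l≢i , l≢j))

∈-tabulate⁺ : ∀ {n} {f : Fin n → Bool} {x} → f x ≡ true → x ∈ tabulate f
∈-tabulate⁺ {f = f} {x} fx = lookup⇒[]= x (tabulate f) (trans (lookup∘tabulate f x) fx)

∈-tabulate⁻ : ∀ {n} {f : Fin n → Bool} {x} → x ∈ tabulate f → f x ≡ true
∈-tabulate⁻ {f = f} {x} x∈ = trans (sym (lookup∘tabulate f x)) ([]=⇒lookup x∈)

sameRole-refl : ∀ ρ → sameRole ρ ρ ≡ true
sameRole-refl rJ1 = refl
sameRole-refl rJ2 = refl
sameRole-refl rW = refl
sameRole-refl rW1 = refl
sameRole-refl rV1 = refl

sameRole-sound : ∀ {ρ σ} → sameRole ρ σ ≡ true → ρ ≡ σ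
sameRole-sound {rJ1} {rJ1} refl = refl
sameRole-sound {rJ2} {rJ2} refl = refl
sameRole-sound {rW} {rW} refl = refl
sameRole-sound {rW1} {rW1} refl = refl
sameRole-sound {rV1} {rV1} refl = refl

leaving-edge : ∀ {n} (G : Graph n) {T} {P : Fin n → Set} → (∀ x → Dec (P x)) →
  ∀ {u v} → WalkIn G T u v → P u → ¬ P v → ∃ λ x → ∃ λ y → P x × ¬ P y × Adj G x y
leaving-edge G P? here Pu ¬Pv = ⊥-elim (¬Pv Pu)
leaving-edge G P? (step {u} {v} uv _ walk) Pu ¬Pw with P? v
... | yes Pv = leaving-edge G P? walk Pv ¬Pw
... | no ¬Pv = u , v , Pu , ¬Pv , uv

-- Arcs, witnesses and separations

module _ {n : ℕ} (G : Graph n) where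

  Dominates : Fin n → Fin n → Fin n → Set
  Dominates u w y = (y ≡ u ⊎ y ≡ w) ⊎ (Adj G u y ⊎ Adj G w y)

  Witness : Fin n → Fin n → Fin n → Set
  Witness u v w = Adj G u w × ¬ Adj G w v × (∀ y → y ≢ v → Dominates u w y)

  Arc : Fin n → Fin n → Set
  Arc u v = ∃ (Witness u v)

  adj? : ∀ x y → Dec (Adj G x y)
  adj? x y = G x y ≟ᵇ true

  arc? : ∀ u v → Dec (Arc u v)
  arc? u v = any? λ w → adj? u w ×-dec ¬? (adj? w v) ×-dec
    all? (λ y → ¬? (y ≟ v) →-dec ((y ≟ u ⊎-dec y ≟ w) ⊎-dec (adj? u y ⊎-dec adj? w y)))

  -- The consequences of being 3-γ_c-critical that the proof uses.
  record IsCritical : Set where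
    field
      symmetric : ∀ {x y} → Adj G x y → Adj G y x
      irreflexive : ∀ {x} → ¬ Adj G x x
      no-dominating-edge : ∀ {u w} → Adj G u w → ¬ (∀ y → Dominates u w y)
      critical : ∀ u v → u ≢ v → ¬ Adj G u v → (∀ y → Dominates u v y) ⊎ (Arc u v ⊎ Arc v u)

  -- The values of `side` on `S` are arbitrary. Since `opposite` ranges over all `x`, both values
  -- occur outside `S`; a side may consist of several components.
  record IsSeparation (S : Subset n) (side : Fin n → Bool) : Set where
    field
      adj⇒same-side : ∀ {x y} → x ∉ S → y ∉ S → Adj G x y → side x ≡ side y
      opposite : ∀ x → ∃ λ y → y ∉ S × side y ≢ side x

module Critical {n} (G : Graph n) (isCritical : IsCritical G) where
  open IsCritical isCritical

  witness-adj : ∀ {u v w y} → Witness G u v w → y ≢ v → ¬ Adj G u y → Adj G w y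
  witness-adj (uw , _ , dom) y≢v ¬uy with dom _ y≢v
  ... | inj₁ (inj₁ refl) = symmetric uw
  ... | inj₁ (inj₂ refl) = ⊥-elim (¬uy uw)
  ... | inj₂ (inj₁ uy) = ⊥-elim (¬uy uy)
  ... | inj₂ (inj₂ wy) = wy

  -- The vertex `t` refutes the alternative that `u` and `v` already dominate `G`, so criticality
  -- leaves only the two arcs.
  orient : ∀ {u v} t → u ≢ v → ¬ Adj G u v → t ≢ u → t ≢ v → ¬ Adj G u t → ¬ Adj G v t → Arc G u v ⊎ Arc G v u
  orient {u} {v} t u≢v ¬uv t≢u t≢v ¬ut ¬vt with critical u v u≢v ¬uv
  ... | inj₂ arc = arc
  ... | inj₁ dom with dom t
  ... | inj₁ (inj₁ t≡u) = ⊥-elim (t≢u t≡u)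
  ... | inj₁ (inj₂ t≡v) = ⊥-elim (t≢v t≡v)
  ... | inj₂ (inj₁ ut) = ⊥-elim (¬ut ut)
  ... | inj₂ (inj₂ vt) = ⊥-elim (¬vt vt)

  IndependentFamily : ∀ {m} → (Fin m → Fin n) → Set
  IndependentFamily e = Injective _≡_ _≡_ e × (∀ i j → ¬ Adj G (e i) (e j))

  independent-triple : ∀ {x y z} → x ≢ y → x ≢ z → y ≢ z →
    ¬ Adj G x y → ¬ Adj G x z → ¬ Adj G y z → IndependentFamily (triple x y z)
  independent-triple {x} {y} {z} x≢y x≢z y≢z ¬xy ¬xz ¬yz = triple-injective x≢y x≢z y≢z , indep
    where
    indep : ∀ i j → ¬ Adj G (triple x y z i) (triple x y z j)
    indep 0F 0F = irreflexive
    indep 0F 1F = ¬xy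
    indep 0F 2F = ¬xz
    indep 1F 0F = ¬xy ∘ symmetric
    indep 1F 1F = irreflexive
    indep 1F 2F = ¬yz
    indep 2F 0F = ¬xz ∘ symmetric
    indep 2F 1F = ¬yz ∘ symmetric
    indep 2F 2F = irreflexive

  -- Arcs in the presence of a cut that contains no whole neighbourhood

  module Separated (S : Subset n) (side : Fin n → Bool) (isSeparation : IsSeparation G S side)
    (exit : ∀ x → ∃ λ y → Adj G x y × y ∉ S) where
    open IsSeparation isSeparation

    apart : ∀ {x y} → x ∉ S → y ∉ S → side x ≢ side y → ¬ Adj G x y
    apart x∉S y∉S d xy = d (adj⇒same-side x∉S y∉S xy)

    apart-≢ : ∀ {x y} → side x ≢ side y → x ≢ y
    apart-≢ d refl = d refl

    crossing : ∀ {w x y} → x ∉ S → y ∉ S → side x ≢ side y → Adj G w x → Adj G w y → w ∈ S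
    crossing {w} x∉S y∉S d wx wy with w ∈? S
    ... | yes w∈S = w∈S
    ... | no w∉S = ⊥-elim (d (trans (sym (adj⇒same-side w∉S x∉S wx)) (adj⇒same-side w∉S y∉S wy)))

    -- Otherwise the edge uw lies on one side, so v is all of the other side and has no neighbour outside S.
    cut : ∀ {u v w} → Witness G u v w → u ∉ S → w ∈ S
    cut {u} {v} {w} W u∉S with w ∈? S
    ... | yes w∈S = w∈S
    ... | no w∉S = ⊥-elim (irreflexive (subst (Adj G y) (trans t≡v (sym y≡v)) yt))
      where
      same : side u ≡ side w
      same = adj⇒same-side u∉S w∉S (proj₁ W)
      only : ∀ y → y ∉ S → side y ≢ side u → y ≡ v
      only y y∉S d with y ≟ v
      ... | yes y≡v = y≡v
      ... | no y≢v = ⊥-elim (d (sym (trans same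
        (adj⇒same-side w∉S y∉S (witness-adj W y≢v (apart u∉S y∉S (≢-sym d)))))))
      opp = opposite u
      y = proj₁ opp
      y∉S = proj₁ (proj₂ opp)
      d = proj₂ (proj₂ opp)
      y≡v = only y y∉S d
      t = proj₁ (exit y)
      yt = proj₁ (proj₂ (exit y))
      t∉S = proj₂ (proj₂ (exit y))
      t≡v = only t t∉S (λ eq → d (trans (adj⇒same-side y∉S t∉S yt) eq))

    -- The outcome of the count: `e r` is the member without a vertex of its own in `S`, and `f`
    -- sends each other member to its own. The value of `f` at `r` carries no information.
    record Source {m} (e : Fin (suc m) → Fin n) : Set where
      field
        r : Fin (suc m)
        r∉S : e r ∉ S
        f : Fin (suc m) → Fin n
        hit : ∀ i → i ≢ r → (e i ∈ S × f i ≡ e i) ⊎ (e i ∉ S × f i ∈ S × Witness G (e r) (e i) (f i))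
        onto : ∀ {s} → s ∈ S → ∃ λ i → i ≢ r × f i ≡ s

    -- In the notation of 𝒢₂(3,3): w = e a, w₁ = x, v₁ = e z, u₁ = y and u₂ = e r.
    record Exceptional {m} (e : Fin (suc m) → Fin n) : Set where
      field
        a r z : Fin (suc m)
        x y : Fin n
        members : ∀ i → (i ≡ a ⊎ i ≡ r) ⊎ i ≡ z
        a∈S : e a ∈ S
        r∉S : e r ∉ S
        z∉S : e z ∉ S
        z-side : side (e z) ≢ side (e r)
        x∈S : x ∈ S
        S⊆ax : ∀ {s} → s ∈ S → s ≡ e a ⊎ s ≡ x
        xa : Adj G x (e a)
        witness : Witness G (e r) (e z) x
        a-dominates : ∀ {c} → c ∉ S → side c ≡ side (e r) → c ≢ e r → Adj G (e a) c
        y∉S : y ∉ S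
        y≢z : y ≢ e z
        ¬xy : ¬ Adj G x y

    -- Counting an independent family with one member more than the cut

    module Family {m} (2≤m : 2 ≤ m) (∣S∣≡m : ∣ S ∣ ≡ m) (e : Fin (suc m) → Fin n)
      (independent : IndependentFamily e) where

      inj = proj₁ independent
      indep = proj₂ independent

      e≢ : ∀ {i j} → i ≢ j → e i ≢ e j
      e≢ i≢j eq = i≢j (inj eq)

      orientI : ∀ {i j} → i ≢ j → Arc G (e i) (e j) ⊎ Arc G (e j) (e i)
      orientI {i} {j} i≢j with another 2≤m i j
      ... | l , l≢i , l≢j = orient (e l) (e≢ i≢j) (indep i j) (e≢ l≢i) (e≢ l≢j) (indep i l) (indep j l)

      witness-adjI : ∀ {i j l w} → Witness G (e i) (e j) w → l ≢ j → Adj G w (e l)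
      witness-adjI {i} {l = l} W l≢j = witness-adj W (e≢ l≢j) (indep i l)

      Mark : Fin (suc m) → Fin n → Set
      Mark i s = s ≡ e i ⊎ ∃ λ j → Witness G (e j) (e i) s

      -- A witness is adjacent to its tail, so it is not a member of `I`; and it misses the head
      -- `e i` while being adjacent to every other member, so it determines `i`.
      mark-injective : ∀ {i i' s} → Mark i s → Mark i' s → i ≡ i'
      mark-injective {i} {i'} (inj₁ p) (inj₁ q) = inj (trans (sym p) q)
      mark-injective {i} {i'} (inj₁ refl) (inj₂ (j , es , _)) = ⊥-elim (indep j i es)
      mark-injective {i} {i'} (inj₂ (j , es , _)) (inj₁ refl) = ⊥-elim (indep j i' es)
      mark-injective {i} {i'} (inj₂ (j , W)) (inj₂ (_ , _ , ¬s , _)) with i ≟ i'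
      ... | yes eq = eq
      ... | no i≢i' = ⊥-elim (¬s (witness-adjI W (≢-sym i≢i')))

      overfull : (g : Fin (suc m) → Fin n) → (∀ i → g i ∈ S) → ¬ Injective _≡_ _≡_ g
      overfull g g∈S g-inj = <⇒≱ ≤-refl (subst (suc m ≤_) ∣S∣≡m (injection⇒≤∣p∣ S g g-inj g∈S))

      -- The tail is required outside `S` because `cut` then places the witness in `S`.
      Hit : Fin (suc m) → Set
      Hit i = e i ∈ S ⊎ ∃ λ j → e j ∉ S × Arc G (e j) (e i)

      hit? : ∀ i → Dec (Hit i)
      hit? i = (e i ∈? S) ⊎-dec any? (λ j → ¬? (e j ∈? S) ×-dec arc? G (e j) (e i))

      hit⇒mark : ∀ i → Hit i → ∃ λ s → s ∈ S × Mark i s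
      hit⇒mark i (inj₁ p) = e i , p , inj₁ refl
      hit⇒mark i (inj₂ (j , j∉S , w , W)) = w , cut W j∉S , inj₂ (j , W)

      unhit : ∃ λ i → ¬ Hit i
      unhit with any? (¬? ∘ hit?)
      ... | yes found = found
      ... | no none = ⊥-elim (overfull (proj₁ ∘ mark) (proj₁ ∘ proj₂ ∘ mark)
              (λ {i} {j} eq → mark-injective (proj₂ (proj₂ (mark i)))
                 (subst (Mark j) (sym eq) (proj₂ (proj₂ (mark j))))))
        where
        mark : ∀ i → ∃ λ s → s ∈ S × Mark i s
        mark i = hit⇒mark i (decidable-stable (hit? i) (λ ¬h → none (i , ¬h)))

      Marks : Fin (suc m) → Fin (suc m) → Fin n → Set
      Marks r i s = (e i ∈ S × s ≡ e i) ⊎ (e i ∉ S × s ∈ S × Witness G (e r) (e i) s)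

      -- A vertex `s` of `S` missed by `f` could be assigned to the free index `r`, which would give
      -- `m + 1` distinct elements of `S`.
      marks-all : ∀ {r s} → (f : Fin (suc m) → Fin n) → (∀ i → i ≢ r → Marks r i (f i)) → s ∈ S →
        ∃ λ i → i ≢ r × f i ≡ s
      marks-all {r} {s} f marks s∈S with any? (λ i → ¬? (i ≟ r) ×-dec (f i ≟ s))
      ... | yes found = found
      ... | no none = ⊥-elim (overfull g g∈S g-inj)
        where
        f∈S : ∀ i → i ≢ r → f i ∈ S
        f∈S i i≢r with marks i i≢r
        ... | inj₁ (i∈S , eq) = subst (_∈ S) (sym eq) i∈S
        ... | inj₂ (_ , p , _) = p
        f-mark : ∀ i → i ≢ r → Mark i (f i)
        f-mark i i≢r with marks i i≢r
        ... | inj₁ (_ , eq) = inj₁ eq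
        ... | inj₂ (_ , _ , W) = inj₂ (r , W)
        g : Fin (suc m) → Fin n
        g i with i ≟ r
        ... | yes _ = s
        ... | no _ = f i
        g∈S : ∀ i → g i ∈ S
        g∈S i with i ≟ r
        ... | yes _ = s∈S
        ... | no i≢r = f∈S i i≢r
        g-inj : Injective _≡_ _≡_ g
        g-inj {i} {j} eq with i ≟ r | j ≟ r
        ... | yes i≡r | yes j≡r = trans i≡r (sym j≡r)
        ... | yes _ | no j≢r = ⊥-elim (none (j , j≢r , sym eq))
        ... | no i≢r | yes _ = ⊥-elim (none (i , i≢r , eq))
        ... | no i≢r | no j≢r = mark-injective (f-mark i i≢r) (subst (Mark j) (sym eq) (f-mark j j≢r))

      -- S is exhausted by the members of I in S and the (distinct) witnesses of the arcs within I ∖ S,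
      -- so all but exactly one member of I belongs to S or is the head of such an arc.
      findSource : Source e
      findSource with unhit
      ... | r , ¬hit = record
        { r = r ; r∉S = ¬hit ∘ inj₁
        ; f = proj₁ ∘ choose ; hit = proj₂ ∘ choose ; onto = marks-all (proj₁ ∘ choose) (proj₂ ∘ choose) }
        where
        choose : ∀ i → ∃ λ s → i ≢ r → Marks r i s
        choose i with i ≟ r | e i ∈? S
        ... | yes i≡r | _ = e i , λ i≢r → ⊥-elim (i≢r i≡r)
        ... | no _ | yes i∈S = e i , λ _ → inj₁ (i∈S , refl)
        ... | no i≢r | no i∉S with orientI i≢r
        ... | inj₁ arc = ⊥-elim (¬hit (inj₂ (i , i∉S , arc)))
        ... | inj₂ (w , W) = w , λ _ → inj₂ (i∉S , cut W (¬hit ∘ inj₁) , W)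

      module WithSource (theSource : Source e) where
        open Source theSource

        -- Otherwise `S` consists of the members other than `e r`, so `e r` has no neighbour in `S`.
        -- At least two members lie in `S`, and `no-arc` forbids the arc between them.
        source-not-alone : ¬ (∀ i → i ≢ r → e i ∈ S)
        source-not-alone others∈S with another 2≤m r r
        ... | a , a≢r , _ with another 2≤m r a
        ... | a' , a'≢r , a'≢a = [ no-arc a'≢a a'≢r , no-arc (≢-sym a'≢a) a≢r ]′ (orientI (≢-sym a'≢a))
          where
          S⊆I : ∀ {s} → s ∈ S → ∃ λ i → s ≡ e i
          S⊆I s∈S with onto s∈S
          ... | i , i≢r , refl with hit i i≢r
          ... | inj₁ (_ , eq) = i , eq
          ... | inj₂ (i∉S , _) = ⊥-elim (i∉S (others∈S i i≢r))
          r≁S : ∀ {s} → s ∈ S → ¬ Adj G (e r) s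
          r≁S s∈S with S⊆I s∈S
          ... | i , refl = indep r i
          -- A non-neighbour `c`, a vertex `h` of the other side and `e r` are independent. The arc
          -- between `c` and `h` has its witness in `S`, and that witness is adjacent to `e r`,
          -- contrary to `r≁S`.
          r-dominates : ∀ {c} → c ∉ S → side c ≡ side (e r) → c ≢ e r → Adj G (e r) c
          r-dominates {c} c∉S same c≢r with adj? G (e r) c
          ... | yes rc = rc
          ... | no ¬rc with opposite (e r)
          ... | h , h∉S , d with orient (e r) c≢h ¬ch (≢-sym c≢r) (apart-≢ (≢-sym d)) (¬rc ∘ symmetric) (apart h∉S r∉S d)
            where
            c≢h : c ≢ h
            c≢h = apart-≢ (λ eq → d (trans (sym eq) same))
            ¬ch : ¬ Adj G c h
            ¬ch = apart c∉S h∉S (λ eq → d (trans (sym eq) same))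
          ... | inj₁ (w , W) = ⊥-elim (r≁S (cut W c∉S) (symmetric (witness-adj W (apart-≢ (≢-sym d)) (¬rc ∘ symmetric))))
          ... | inj₂ (w , W) = ⊥-elim (r≁S (cut W h∉S) (symmetric (witness-adj W (≢-sym c≢r) (apart h∉S r∉S d))))
          -- The witness `x` is adjacent to `e r`, hence outside `S` and on its side. An arc from
          -- `e r` to `e j` contradicts `r≁S`. The witness `w` of the reverse arc is outside `S` and
          -- misses `e r`, so it lies on the other side; yet `e j` misses `x`, so `w` would have to
          -- be adjacent to `x`.
          no-arc : ∀ {i j} → j ≢ i → j ≢ r → ¬ Arc G (e i) (e j)
          no-arc {i} {j} j≢i j≢r (x , X) with orientI j≢r
          ... | inj₂ (w , W) = r≁S (cut W r∉S) (proj₁ W)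
          ... | inj₁ (w , W) = w-sides (side w ≟ᵇ side (e r))
            where
            rx : Adj G (e r) x
            rx = symmetric (witness-adjI X (≢-sym j≢r))
            x∉S : x ∉ S
            x∉S x∈S = r≁S x∈S rx
            w∉S : w ∉ S
            w∉S w∈S with S⊆I w∈S
            ... | l , refl = indep j l (proj₁ W)
            w≢r : w ≢ e r
            w≢r refl = indep j r (proj₁ W)
            x≢r : x ≢ e r
            x≢r refl = irreflexive rx
            w-sides : Dec (side w ≡ side (e r)) → ⊥
            w-sides (yes same) = proj₁ (proj₂ W) (symmetric (r-dominates w∉S same w≢r))
            w-sides (no d) = apart w∉S x∉S (λ eq → d (trans eq (sym (adj⇒same-side r∉S x∉S rx))))
              (witness-adj W x≢r (proj₁ (proj₂ X) ∘ symmetric))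

        -- Structure of the cut seen from the source

        f-witness : ∀ {v} → v ≢ r → e v ∉ S → f v ∈ S × Witness G (e r) (e v) (f v)
        f-witness {v} v≢r v∉S with hit v v≢r
        ... | inj₁ (v∈S , _) = ⊥-elim (v∉S v∈S)
        ... | inj₂ (_ , p) = p

        witness-in-S : ∀ {w} → w ∈ S →
          (∃ λ l → w ≡ e l) ⊎ (∃ λ l → l ≢ r × e l ∉ S × f l ≡ w × Witness G (e r) (e l) w)
        witness-in-S w∈S with onto w∈S
        ... | l , l≢r , refl with hit l l≢r
        ... | inj₁ (_ , eq) = inj₁ (l , eq)
        ... | inj₂ (l∉S , _ , W) = inj₂ (l , l≢r , l∉S , refl , W)

        -- By `cut` the witness is in `S`. It is no member of `I`, being adjacent to `e i`, so it is
        -- some `f l`, and the only member missed by `f l` is `e l`. All arcs into `e j` from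
        -- members outside `S` thus share one witness.
        arc-into : ∀ {i j w} → e i ∉ S → Witness G (e i) (e j) w → e j ∉ S × j ≢ r × f j ≡ w
        arc-into {i} {j} i∉S W with witness-in-S (cut W i∉S)
        ... | inj₁ (l , refl) = ⊥-elim (indep i l (proj₁ W))
        ... | inj₂ (l , l≢r , l∉S , eq , _ , ¬wl , _) with l ≟ j
        ... | yes refl = l∉S , l≢r , eq
        ... | no l≢j = ⊥-elim (¬wl (witness-adjI W l≢j))

        f-adj : ∀ {v l} → v ≢ r → e v ∉ S → l ≢ v → Adj G (f v) (e l)
        f-adj v≢r v∉S l≢v = witness-adjI (proj₂ (f-witness v≢r v∉S)) l≢v

        -- An arc from `e u` to `e v` has witness `f v`. As `e u` misses `f u`, the vertex `f u`
        -- must be adjacent to `f v`.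
        f-clique : ∀ {u v} → u ≢ v → u ≢ r → e u ∉ S → v ≢ r → e v ∉ S → Adj G (f u) (f v)
        f-clique u≢v u≢r u∉S v≢r v∉S =
          [ symmetric ∘ half u≢r u∉S , half v≢r v∉S ]′ (orientI u≢v)
          where
          half : ∀ {u v} → u ≢ r → e u ∉ S → Arc G (e u) (e v) → Adj G (f v) (f u)
          half {u} {v} u≢r u∉S (w , W) with arc-into u∉S W | f-witness u≢r u∉S
          ... | _ , _ , refl | _ , rfu , ¬fu , _ = witness-adj W fu≢v (¬fu ∘ symmetric)
            where
            fu≢v : f u ≢ e v
            fu≢v eq = indep r v (subst (Adj G (e r)) eq rfu)

        f-dominates-S : ∀ {v s} → v ≢ r → e v ∉ S → s ∈ S → s ≡ f v ⊎ Adj G (f v) s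
        f-dominates-S {v} v≢r v∉S s∈S with onto s∈S
        ... | l , l≢r , refl with l ≟ v
        ... | yes refl = inj₁ refl
        ... | no l≢v with hit l l≢r
        ... | inj₁ (_ , eq) = inj₂ (subst (Adj G (f v)) (sym eq) (f-adj v≢r v∉S l≢v))
        ... | inj₂ (l∉S , _) = inj₂ (f-clique (≢-sym l≢v) v≢r v∉S l≢r l∉S)

        -- Otherwise f v and any neighbour of v outside S form a dominating edge.
        escape : ∀ {v} → v ≢ r → e v ∉ S → ∃ λ y → y ∉ S × y ≢ e v × ¬ Adj G (f v) y
        escape {v} v≢r v∉S with any? (λ y → ¬? (y ∈? S) ×-dec ¬? (y ≟ e v) ×-dec ¬? (adj? G (f v) y))
        ... | yes found = found
        ... | no none = ⊥-elim (no-dominating-edge (all-adj y∉S (λ eq → irreflexive (subst (Adj G (e v)) eq vy))) dom)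
          where
          y = proj₁ (exit (e v))
          vy = proj₁ (proj₂ (exit (e v)))
          y∉S = proj₂ (proj₂ (exit (e v)))
          all-adj : ∀ {t} → t ∉ S → t ≢ e v → Adj G (f v) t
          all-adj {t} t∉S t≢v = decidable-stable (adj? G (f v) t) (λ ¬ft → none (t , t∉S , t≢v , ¬ft))
          dom : ∀ t → Dominates G (f v) y t
          dom t with t ∈? S | t ≟ e v
          ... | yes t∈S | _ = [ inj₁ ∘ inj₁ , inj₂ ∘ inj₁ ]′ (f-dominates-S v≢r v∉S t∈S)
          ... | no _ | yes refl = inj₂ (inj₂ (symmetric vy))
          ... | no t∉S | no t≢v = inj₂ (inj₁ (all-adj t∉S t≢v))

        -- The tails `e i` and `e r` share the witness `f v`, which misses the vertex `y` given by
        -- `escape`. Both tails therefore have to lie on the side of `y`.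
        heads-same-side : ∀ {i v} → v ≢ r → e v ∉ S → e i ∉ S → Arc G (e i) (e v) → side (e i) ≡ side (e r)
        heads-same-side {i} {v} v≢r v∉S i∉S (w , W) with escape v≢r v∉S | arc-into i∉S W
        ... | y , y∉S , y≢v , ¬fy | _ , _ , refl =
          trans (same i∉S W) (sym (same r∉S (proj₂ (f-witness v≢r v∉S))))
          where
          same : ∀ {u} → u ∉ S → Witness G u (e v) (f v) → side u ≡ side y
          same {u} u∉S W' with side u ≟ᵇ side y
          ... | yes eq = eq
          ... | no d = ⊥-elim (¬fy (witness-adj W' y≢v (apart u∉S y∉S d)))

        -- Otherwise some further member `e v` outside `S` is on the side of `e r`, and a vertex `h`
        -- of the other side completes an independent triple. No vertex of `S` can be the witness of
        -- an arc between `e r` and `h`.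
        exists-opposite : ∃ λ z → e z ∉ S × side (e z) ≢ side (e r)
        exists-opposite with any? (λ z → ¬? (e z ∈? S) ×-dec ¬? (side (e z) ≟ᵇ side (e r)))
        ... | yes found = found
        ... | no none = ⊥-elim (source-not-alone (λ v v≢r → decidable-stable (e v ∈? S) (contra v v≢r)))
          where
          same : ∀ {i} → e i ∉ S → side (e i) ≡ side (e r)
          same {i} i∉S = decidable-stable (side (e i) ≟ᵇ side (e r)) (λ d → none (i , i∉S , d))
          contra : ∀ v → v ≢ r → e v ∉ S → ⊥
          contra v v≢r v∉S with opposite (e r)
          ... | h , h∉S , d with orient (e v) (apart-≢ (≢-sym d)) (apart r∉S h∉S (≢-sym d)) (e≢ v≢r)
                                 (apart-≢ v-h) (indep r v) (apart h∉S v∉S (≢-sym v-h))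
            where
            v-h : side (e v) ≢ side h
            v-h eq = d (trans (sym eq) (same v∉S))
          contra v v≢r v∉S | h , h∉S , d | inj₁ (w , W) with witness-in-S (cut W r∉S)
          ... | inj₁ (l , refl) = indep r l (proj₁ W)
          ... | inj₂ (l , _ , l∉S , _ , W') = proj₁ (proj₂ W)
            (witness-adj W' (λ { refl → d (same l∉S) }) (apart r∉S h∉S (≢-sym d)))
          contra v v≢r v∉S | h , h∉S , d | inj₂ (w , W) with witness-in-S (cut W h∉S)
          ... | inj₁ (l , refl) = indep l v (witness-adj W (e≢ v≢r) (apart h∉S v∉S (λ eq → d (trans eq (same v∉S)))))
          ... | inj₂ (_ , _ , _ , _ , rw , _) = proj₁ (proj₂ W) (symmetric rw)

        module WithOpposite (z : Fin (suc m)) (z∉S : e z ∉ S) (z-side : side (e z) ≢ side (e r)) where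

          z≢r : z ≢ r
          z≢r eq = z-side (cong (side ∘ e) eq)

          -- For `u` other than `r`, whichever of `e u` and `e z` is the tail of the arc between
          -- them lies on the side of `e r`; so the tail is `e u`.
          rest-same-side : ∀ {u} → e u ∉ S → u ≢ z → side (e u) ≡ side (e r)
          rest-same-side {u} u∉S u≢z with u ≟ r
          ... | yes refl = refl
          ... | no u≢r with orientI u≢z
          ... | inj₁ arc = heads-same-side z≢r z∉S u∉S arc
          ... | inj₂ arc = ⊥-elim (z-side (heads-same-side u≢r u∉S z∉S arc))

          -- A vertex of `S` is either a member of `I`, hence not adjacent to `e l`, or a value of
          -- `f` at a member outside `S`, hence adjacent to `e r`.
          no-common-witness : ∀ {l w} → w ∈ S → ¬ Witness G (e l) (e r) w
          no-common-witness {l} w∈S (lw , ¬wr , _) with witness-in-S w∈S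
          ... | inj₁ (l' , refl) = indep l l' lw
          ... | inj₂ (_ , _ , _ , _ , rw , _) = ¬wr (symmetric rw)

          z-opposite : ∀ {u} → e u ∉ S → u ≢ z → side (e z) ≢ side (e u)
          z-opposite u∉S u≢z eq = z-side (trans eq (rest-same-side u∉S u≢z))

          -- By `arc-into`, a member `e l` in `S` is no head of an arc from `e r`, so it is the tail
          -- of one into `e r`. The witness is adjacent to `e z` and `e u` on opposite sides, hence
          -- in `S`, against `no-common-witness`.
          I∩S-empty : ∀ {u} → e u ∉ S → u ≢ r → u ≢ z → ∀ l → e l ∉ S
          I∩S-empty {u} u∉S u≢r u≢z l l∈S with orientI {l} {r} (λ { refl → r∉S l∈S })
          ... | inj₂ (w , W) = proj₁ (arc-into r∉S W) l∈S
          ... | inj₁ (w , W) = no-common-witness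
            (crossing z∉S u∉S (z-opposite u∉S u≢z) (witness-adjI W z≢r) (witness-adjI W u≢r)) W

          module TwoOutside (two-outside : ∀ u → e u ∉ S → u ≡ r ⊎ u ≡ z) where

            f-z = f-witness z≢r z∉S

            -- The witness would be adjacent to `e z` and `e r`, hence in `S`. Not being a member,
            -- it could only be `f z`, which is adjacent to `e b`.
            at-most-one-in-S : ∀ {a b} → e a ∈ S → e b ∈ S → ¬ Arc G (e a) (e b)
            at-most-one-in-S {a} {b} a∈S b∈S (w , W)
              with witness-in-S (crossing z∉S r∉S z-side (witness-adjI W (λ { refl → z∉S b∈S }))
                                                         (witness-adjI W (λ { refl → r∉S b∈S })))
            ... | inj₁ (l , refl) = indep a l (proj₁ W)
            ... | inj₂ (l , l≢r , l∉S , eq , _) with two-outside l l∉S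
            ... | inj₁ l≡r = l≢r l≡r
            ... | inj₂ refl = proj₁ (proj₂ W)
              (subst (λ v → Adj G v (e b)) eq (f-adj z≢r z∉S (λ { refl → z∉S b∈S })))

            exceptional : Exceptional e
            exceptional with another 2≤m r z
            ... | a , a≢r , a≢z = record
              { a = a ; r = r ; z = z ; x = f z ; y = proj₁ esc
              ; members = members ; a∈S = a∈S ; r∉S = r∉S ; z∉S = z∉S ; z-side = z-side
              ; x∈S = proj₁ f-z ; S⊆ax = S⊆ax ; xa = f-adj z≢r z∉S a≢z ; witness = proj₂ f-z
              ; a-dominates = a-dominates
              ; y∉S = proj₁ (proj₂ esc) ; y≢z = proj₁ (proj₂ (proj₂ esc)) ; ¬xy = proj₂ (proj₂ (proj₂ esc)) }
              where
              esc = escape z≢r z∉S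
              a∈S : e a ∈ S
              a∈S with e a ∈? S
              ... | yes p = p
              ... | no a∉S = ⊥-elim ([ a≢r , a≢z ]′ (two-outside a a∉S))
              members : ∀ i → (i ≡ a ⊎ i ≡ r) ⊎ i ≡ z
              members i with e i ∈? S
              ... | no i∉S = [ inj₁ ∘ inj₂ , inj₂ ]′ (two-outside i i∉S)
              ... | yes i∈S with i ≟ a
              ... | yes i≡a = inj₁ (inj₁ i≡a)
              ... | no i≢a = ⊥-elim ([ at-most-one-in-S i∈S a∈S , at-most-one-in-S a∈S i∈S ]′ (orientI i≢a))
              S⊆ax : ∀ {s} → s ∈ S → s ≡ e a ⊎ s ≡ f z
              S⊆ax s∈S with onto s∈S
              ... | l , l≢r , refl with members l
              ... | inj₁ (inj₂ l≡r) = ⊥-elim (l≢r l≡r)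
              ... | inj₂ refl = inj₂ refl
              ... | inj₁ (inj₁ refl) with hit a a≢r
              ... | inj₁ (_ , eq) = inj₁ eq
              ... | inj₂ (a∉S , _) = ⊥-elim (a∉S a∈S)
              -- The arc between the two runs from `e a` to `e r`, with a witness outside `S`.
              -- Adjacent to `e z`, this witness is on the other side and cannot be adjacent to `c`,
              -- so `e a` is.
              a-dominates : ∀ {c} → c ∉ S → side c ≡ side (e r) → c ≢ e r → Adj G (e a) c
              a-dominates {c} c∉S same c≢r with orientI a≢r
              ... | inj₂ (w , W) = ⊥-elim (proj₁ (arc-into r∉S W) a∈S)
              ... | inj₁ (w , W) with w ∈? S
              ... | yes w∈S = ⊥-elim (no-common-witness w∈S W)
              ... | no w∉S = decidable-stable (adj? G (e a) c) λ ¬ac →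
                apart w∉S c∉S (λ eq → z-side (trans (sym (adj⇒same-side w∉S z∉S (witness-adjI W z≢r))) (trans eq same)))
                  (witness-adj W c≢r ¬ac)

    module _ {m} (2≤m : 2 ≤ m) (∣S∣≡m : ∣ S ∣ ≡ m) (e : Fin (suc m) → Fin n)
      (independent : IndependentFamily e) where
      open Family 2≤m ∣S∣≡m e independent

      module _ (theSource : Source e) where
        open WithSource theSource
        open Source theSource

        module _ (z : Fin (suc m)) (z∉S : e z ∉ S) (z-side : side (e z) ≢ side (e r)) where
          open WithOpposite z z∉S z-side

          -- Exchanging z for a neighbour h outside S gives another independent family missing S,
          -- but f z, which must miss a member of it, is adjacent to all of them.
          no-third-outside : ∀ u → e u ∉ S → u ≢ r → u ≢ z → ⊥
          no-third-outside u u∉S u≢r u≢z with exit (e z)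
          ... | h , zh , h∉S = contra (Family.findSource 2≤m ∣S∣≡m e' independent')
            where
            I∉S = I∩S-empty u∉S u≢r u≢z
            same-h = adj⇒same-side z∉S h∉S zh
            h-side : ∀ {l} → l ≢ z → side h ≢ side (e l)
            h-side {l} l≢z eq = z-opposite (I∉S l) l≢z (trans same-h eq)
            e' : Fin (suc m) → Fin n
            e' l with l ≟ z
            ... | yes _ = h
            ... | no _ = e l
            independent' : IndependentFamily e'
            independent' = inj' , indep'
              where
              inj' : Injective _≡_ _≡_ e'
              inj' {i} {j} eq with i ≟ z | j ≟ z
              ... | yes i≡z | yes j≡z = trans i≡z (sym j≡z)
              ... | yes _ | no j≢z = ⊥-elim (apart-≢ (h-side j≢z) eq)
              ... | no i≢z | yes _ = ⊥-elim (apart-≢ (h-side i≢z) (sym eq))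
              ... | no _ | no _ = inj eq
              indep' : ∀ i j → ¬ Adj G (e' i) (e' j)
              indep' i j with i ≟ z | j ≟ z
              ... | yes _ | yes _ = irreflexive
              ... | yes _ | no j≢z = apart h∉S (I∉S j) (h-side j≢z)
              ... | no i≢z | yes _ = apart h∉S (I∉S i) (h-side i≢z) ∘ symmetric
              ... | no _ | no _ = indep i j
            e'∉S : ∀ l → e' l ∉ S
            e'∉S l with l ≟ z
            ... | yes _ = h∉S
            ... | no _ = I∉S l
            fz-adj : ∀ l → Adj G (f z) (e' l)
            fz-adj l with l ≟ z
            ... | no l≢z = f-adj z≢r z∉S l≢z
            ... | yes _ = witness-adj (proj₂ (f-witness z≢r z∉S))
              (λ eq → irreflexive (subst (Adj G (e z)) eq zh))
              (apart r∉S h∉S (≢-sym (h-side (≢-sym z≢r))))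
            contra : Source e' → ⊥
            contra src with Source.onto src (proj₁ (f-witness z≢r z∉S))
            ... | l , l≢r , eq with Source.hit src l l≢r
            ... | inj₁ (l∈S , _) = e'∉S l l∈S
            ... | inj₂ (_ , _ , _ , ¬fl , _) = ¬fl (subst (λ v → Adj G v (e' l)) (sym eq) (fz-adj l))

          two-outside : ∀ u → e u ∉ S → u ≡ r ⊎ u ≡ z
          two-outside u u∉S with u ≟ r | u ≟ z
          ... | yes u≡r | _ = inj₁ u≡r
          ... | no _ | yes u≡z = inj₂ u≡z
          ... | no u≢r | no u≢z = ⊥-elim (no-third-outside u u∉S u≢r u≢z)

      abstract
        exceptional : Exceptional e
        exceptional with findSource
        ... | src with WithSource.exists-opposite src
        ... | z , z∉S , z-side = WithSource.WithOpposite.TwoOutside.exceptional src z z∉S z-side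
            (two-outside src z z∉S z-side)

    exceptional⇒m≡2 : ∀ {m} {e : Fin (suc m) → Fin n} → 2 ≤ m → Exceptional e → m ≡ 2
    exceptional⇒m≡2 {m} 2≤m exc = ≤-antisym (s≤s⁻¹ (≤-trans (injection⇒≤∣p∣ p id id cover) ∣p∣≤3)) 2≤m
      where
      open Exceptional exc
      p = (⁅ a ⁆ ∪ ⁅ r ⁆) ∪ ⁅ z ⁆
      ∣p∣≤3 : ∣ p ∣ ≤ 3
      ∣p∣≤3 = ≤-trans (∣p∪q∣≤∣p∣+∣q∣ (⁅ a ⁆ ∪ ⁅ r ⁆) ⁅ z ⁆) (+-mono-≤ (∣⁅x⁆∪⁅y⁆∣≤2 a r) (≤-reflexive (∣⁅x⁆∣≡1 z)))
      cover : ∀ i → i ∈ p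
      cover i with members i
      ... | inj₁ (inj₁ refl) = x∈p∪q⁺ (inj₁ (x∈p∪q⁺ (inj₁ (x∈⁅x⁆ i))))
      ... | inj₁ (inj₂ refl) = x∈p∪q⁺ (inj₁ (x∈p∪q⁺ {p = ⁅ a ⁆} (inj₂ (x∈⁅x⁆ i))))
      ... | inj₂ refl = x∈p∪q⁺ {p = ⁅ a ⁆ ∪ ⁅ r ⁆} (inj₂ (x∈⁅x⁆ i))

    -- Cuts of two vertices and the class 𝒢₂(3,3)

    module TwoElementCut (∣S∣≡2 : ∣ S ∣ ≡ 2) (e : Fin 3 → Fin n) (independent : IndependentFamily e)
      (exc : Exceptional e) (3≤degree : ∀ v → 3 ≤ degree G v) where
      open Exceptional exc

      A = e a
      R = e r
      Z = e z

      -- With `∣ S ∣` equal to 2, any independent triple has the size required of a family, so the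
      -- structure of `e` is available for triples chosen at will.
      exceptional-triple : ∀ {u v w} → IndependentFamily (triple u v w) → Exceptional (triple u v w)
      exceptional-triple = exceptional ≤-refl ∣S∣≡2 _

      ∈∉⇒≢ : ∀ {u v} → u ∈ S → v ∉ S → u ≢ v
      ∈∉⇒≢ u∈S v∉S refl = v∉S u∈S

      ¬AR : ¬ Adj G A R
      ¬AR = proj₂ independent a r
      ¬AZ : ¬ Adj G A Z
      ¬AZ = proj₂ independent a z
      RX : Adj G R x
      RX = proj₁ witness
      ¬XZ : ¬ Adj G x Z
      ¬XZ = proj₁ (proj₂ witness)
      X≢A : x ≢ A
      X≢A eq = irreflexive (subst (Adj G x) (sym eq) xa)

      side-Z : ∀ {c} → side c ≢ side R → side c ≡ side Z
      side-Z d = trans (¬-not d) (sym (¬-not z-side))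

      side-Z≢R : ∀ {c d} → side c ≡ side Z → side d ≡ side R → side c ≢ side d
      side-Z≢R p q eq = z-side (trans (sym p) (trans eq q))

      -- Otherwise `c`, `d` and a vertex of the other side form an independent triple avoiding `S`,
      -- whereas an exceptional triple has a member in `S`.
      clique : ∀ {c d} → c ∉ S → d ∉ S → side c ≡ side d → c ≢ d → Adj G c d
      clique {c} {d} c∉S d∉S same c≢d = decidable-stable (adj? G c d) contra
        where
        contra : ¬ ¬ Adj G c d
        contra ¬cd with opposite c
        ... | g , g∉S , g-side with exceptional-triple
                (independent-triple c≢d (apart-≢ (≢-sym g-side)) (apart-≢ (λ eq → g-side (sym (trans same eq))))
                  ¬cd (apart c∉S g∉S (≢-sym g-side)) (apart d∉S g∉S (λ eq → g-side (sym (trans same eq)))))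
        ... | E with Exceptional.a E | Exceptional.a∈S E
        ... | 0F | c∈S = c∉S c∈S
        ... | 1F | d∈S = d∉S d∈S
        ... | 2F | g∈S = g∉S g∈S

      X-dominates-Z-side : ∀ {h} → h ∉ S → side h ≡ side Z → h ≢ Z → Adj G x h
      X-dominates-Z-side h∉S same h≢Z = witness-adj witness h≢Z (apart r∉S h∉S (≢-sym (side-Z≢R same refl)))

      -- If `A` missed `h`, the triple `A`, `h`, `R` would be exceptional with `x` as its witness,
      -- so `x` would miss `h` or `R`; it is adjacent to both.
      A-dominates-Z-side : ∀ {h} → h ∉ S → side h ≡ side Z → h ≢ Z → Adj G A h
      A-dominates-Z-side {h} h∉S same h≢Z = decidable-stable (adj? G A h) contra
        where
        d = side-Z≢R same refl
        contra : ¬ ¬ Adj G A h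
        contra ¬Ah = not-exceptional (exceptional-triple (independent-triple
            (∈∉⇒≢ a∈S h∉S) (∈∉⇒≢ a∈S r∉S) (apart-≢ d) ¬Ah ¬AR (apart h∉S r∉S d)))
          where
          not-exceptional : ¬ Exceptional (triple A h R)
          not-exceptional E = from-cover (Exceptional.S⊆ax E x∈S)
            where
            from-cover : x ≡ triple A h R (Exceptional.a E) ⊎ x ≡ Exceptional.x E → ⊥
            from-cover (inj₁ eq) with Exceptional.a E | Exceptional.a∈S E
            ... | 0F | _ = X≢A eq
            ... | 1F | h∈S = h∉S h∈S
            ... | 2F | r∈S = r∉S r∈S
            from-cover (inj₂ eq) with Exceptional.z E | Exceptional.z∉S E | Exceptional.witness E
            ... | 0F | a∉S | _ = a∉S a∈S
            ... | 1F | _ | _ , ¬xh , _ = ¬xh (subst (λ v → Adj G v h) eq (X-dominates-Z-side h∉S same h≢Z))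
            ... | 2F | _ | _ , ¬xr , _ = ¬xr (subst (λ v → Adj G v R) eq (symmetric RX))

      y-side : side y ≡ side R
      y-side = decidable-stable (side y ≟ᵇ side R)
        (λ d → ¬xy (witness-adj witness y≢z (apart r∉S y∉S (≢-sym d))))

      y≢R : y ≢ R
      y≢R eq = ¬xy (subst (Adj G x) (sym eq) (symmetric RX))

      -- In the exceptional triple `x`, `y`, `Z` the cut vertices exchange roles. Its witness is now
      -- `A`, which is adjacent to `y` and so misses `Z`; hence `y` plays the part of `R`, and
      -- `a-dominates` for this triple is the claim.
      X-dominates-R-side : ∀ {c} → c ∉ S → side c ≡ side R → c ≢ y → Adj G x c
      X-dominates-R-side {c} c∉S same c≢y
        with exceptional-triple (independent-triple (∈∉⇒≢ x∈S y∉S) (∈∉⇒≢ x∈S z∉S) y≢z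
               ¬xy ¬XZ (apart y∉S z∉S (≢-sym (side-Z≢R refl y-side))))
      ... | E with Exceptional.a E | Exceptional.a∈S E | Exceptional.xa E | Exceptional.a-dominates E
      ... | 1F | y∈S | _ | _ = ⊥-elim (y∉S y∈S)
      ... | 2F | z∈S | _ | _ = ⊥-elim (z∉S z∈S)
      ... | 0F | _ | x'x | x-dominates with S⊆ax (Exceptional.x∈S E)
      ... | inj₂ eq = ⊥-elim (irreflexive (subst (λ v → Adj G v x) eq x'x))
      ... | inj₁ eq with Exceptional.z E | Exceptional.z∉S E | Exceptional.z-side E | Exceptional.witness E
      ... | 0F | x∉S | _ | _ = ⊥-elim (x∉S x∈S)
      ... | 1F | _ | _ | _ , ¬Ay , _ = ⊥-elim (¬Ay (subst (λ v → Adj G v y) (sym eq) (a-dominates y∉S y-side y≢R)))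
      ... | 2F | _ | zr-side | _ with Exceptional.r E | Exceptional.r∉S E
      ... | 0F | x∉S = ⊥-elim (x∉S x∈S)
      ... | 1F | _ = x-dominates c∉S (trans same (sym y-side)) c≢y
      ... | 2F | _ = ⊥-elim (zr-side refl)

      data Kind (c : Fin n) : Role → Set where
        isZ : c ≡ Z → Kind c rV1
        isA : c ≡ A → Kind c rW
        isX : c ≡ x → Kind c rW1
        isJ₁ : c ∉ S → side c ≡ side Z → c ≢ Z → Kind c rJ1
        isJ₂ : c ∉ S → side c ≡ side R → Kind c rJ2

      classify : ∀ c → ∃ (Kind c)
      classify c with c ∈? S | c ≟ Z | side c ≟ᵇ side R
      ... | no c∉S | yes c≡Z | _ = rV1 , isZ c≡Z
      ... | no c∉S | no c≢Z | yes same = rJ2 , isJ₂ c∉S same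
      ... | no c∉S | no c≢Z | no d = rJ1 , isJ₁ c∉S (side-Z d) c≢Z
      ... | yes c∈S | _ | _ with S⊆ax c∈S
      ... | inj₁ c≡A = rW , isA c≡A
      ... | inj₂ c≡X = rW1 , isX c≡X

      kind-unique : ∀ {c ρ σ} → Kind c ρ → Kind c σ → ρ ≡ σ
      kind-unique (isZ _) (isZ _) = refl
      kind-unique (isZ refl) (isA eq) = ⊥-elim (∈∉⇒≢ a∈S z∉S (sym eq))
      kind-unique (isZ refl) (isX eq) = ⊥-elim (∈∉⇒≢ x∈S z∉S (sym eq))
      kind-unique (isZ refl) (isJ₁ _ _ c≢Z) = ⊥-elim (c≢Z refl)
      kind-unique (isZ refl) (isJ₂ _ same) = ⊥-elim (z-side same)
      kind-unique (isA _) (isA _) = refl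
      kind-unique (isA refl) (isZ eq) = ⊥-elim (∈∉⇒≢ a∈S z∉S eq)
      kind-unique (isA refl) (isX eq) = ⊥-elim (X≢A (sym eq))
      kind-unique (isA refl) (isJ₁ a∉S _ _) = ⊥-elim (a∉S a∈S)
      kind-unique (isA refl) (isJ₂ a∉S _) = ⊥-elim (a∉S a∈S)
      kind-unique (isX _) (isX _) = refl
      kind-unique (isX refl) (isZ eq) = ⊥-elim (∈∉⇒≢ x∈S z∉S eq)
      kind-unique (isX refl) (isA eq) = ⊥-elim (X≢A eq)
      kind-unique (isX refl) (isJ₁ x∉S _ _) = ⊥-elim (x∉S x∈S)
      kind-unique (isX refl) (isJ₂ x∉S _) = ⊥-elim (x∉S x∈S)
      kind-unique (isJ₁ _ _ _) (isJ₁ _ _ _) = refl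
      kind-unique (isJ₁ _ _ c≢Z) (isZ eq) = ⊥-elim (c≢Z eq)
      kind-unique (isJ₁ a∉S _ _) (isA refl) = ⊥-elim (a∉S a∈S)
      kind-unique (isJ₁ x∉S _ _) (isX refl) = ⊥-elim (x∉S x∈S)
      kind-unique (isJ₁ _ p _) (isJ₂ _ q) = ⊥-elim (side-Z≢R p q refl)
      kind-unique (isJ₂ _ _) (isJ₂ _ _) = refl
      kind-unique (isJ₂ _ same) (isZ refl) = ⊥-elim (z-side same)
      kind-unique (isJ₂ a∉S _) (isA refl) = ⊥-elim (a∉S a∈S)
      kind-unique (isJ₂ x∉S _) (isX refl) = ⊥-elim (x∉S x∈S)
      kind-unique (isJ₂ _ q) (isJ₁ _ p _) = ⊥-elim (side-Z≢R p q refl)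

      module Roles (classify : ∀ c → ∃ (Kind c)) where

        role : Fin n → Role
        role = proj₁ ∘ classify

        kind-of : ∀ {c ρ} → role c ≡ ρ → Kind c ρ
        kind-of {c} refl = proj₂ (classify c)

        role-of : ∀ {c ρ} → Kind c ρ → role c ≡ ρ
        role-of {c} = kind-unique (proj₂ (classify c))

        spec⇒adj : ∀ {c d} → c ≢ d → Spec role y R c d → Adj G c d
        spec⇒adj c≢d (inj₁ (p , q)) with kind-of p | kind-of q
        ... | isJ₁ c∉S c-side _ | isJ₁ d∉S d-side _ = clique c∉S d∉S (trans c-side (sym d-side)) c≢d
        spec⇒adj c≢d (inj₂ (inj₁ (p , q))) with kind-of p | kind-of q
        ... | isJ₂ c∉S c-side | isJ₂ d∉S d-side = clique c∉S d∉S (trans c-side (sym d-side)) c≢d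
        spec⇒adj c≢d (inj₂ (inj₂ (inj₁ (p , q)))) with kind-of p | kind-of q
        ... | isZ refl | isJ₁ d∉S d-side _ = clique z∉S d∉S (sym d-side) c≢d
        spec⇒adj c≢d (inj₂ (inj₂ (inj₂ (inj₁ (p , q))))) with kind-of p | kind-of q
        ... | isX refl | isJ₁ d∉S d-side d≢Z = X-dominates-Z-side d∉S d-side d≢Z
        spec⇒adj c≢d (inj₂ (inj₂ (inj₂ (inj₂ (inj₁ (p , q , d≢y)))))) with kind-of p | kind-of q
        ... | isX refl | isJ₂ d∉S d-side = X-dominates-R-side d∉S d-side d≢y
        spec⇒adj c≢d (inj₂ (inj₂ (inj₂ (inj₂ (inj₂ (inj₁ (p , q))))))) with kind-of p | kind-of q
        ... | isX refl | isA refl = xa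
        spec⇒adj c≢d (inj₂ (inj₂ (inj₂ (inj₂ (inj₂ (inj₂ (inj₁ (p , q)))))))) with kind-of p | kind-of q
        ... | isA refl | isJ₁ d∉S d-side d≢Z = A-dominates-Z-side d∉S d-side d≢Z
        spec⇒adj c≢d (inj₂ (inj₂ (inj₂ (inj₂ (inj₂ (inj₂ (inj₂ (p , q , d≢R)))))))) with kind-of p | kind-of q
        ... | isA refl | isJ₂ d∉S d-side = a-dominates d∉S d-side d≢R

        adj⇒spec : ∀ {c d ρ σ} → Kind c ρ → Kind d σ → role c ≡ ρ → role d ≡ σ → Adj G c d →
          Spec role y R c d ⊎ Spec role y R d c
        adj⇒spec (isZ refl) (isZ refl) _ _ cd = ⊥-elim (irreflexive cd)
        adj⇒spec (isZ refl) (isA refl) _ _ cd = ⊥-elim (¬AZ (symmetric cd))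
        adj⇒spec (isZ refl) (isX refl) _ _ cd = ⊥-elim (¬XZ (symmetric cd))
        adj⇒spec (isZ refl) (isJ₁ _ _ _) p q _ = inj₁ (inj₂ (inj₂ (inj₁ (p , q))))
        adj⇒spec (isZ refl) (isJ₂ d∉S d-side) _ _ cd = ⊥-elim (apart z∉S d∉S (side-Z≢R refl d-side) cd)
        adj⇒spec (isA refl) (isZ refl) _ _ cd = ⊥-elim (¬AZ cd)
        adj⇒spec (isA refl) (isA refl) _ _ cd = ⊥-elim (irreflexive cd)
        adj⇒spec (isA refl) (isX refl) p q _ = inj₂ (inj₂ (inj₂ (inj₂ (inj₂ (inj₂ (inj₁ (q , p)))))))
        adj⇒spec (isA refl) (isJ₁ _ _ _) p q _ = inj₁ (inj₂ (inj₂ (inj₂ (inj₂ (inj₂ (inj₂ (inj₁ (p , q))))))))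
        adj⇒spec (isA refl) (isJ₂ _ _) p q cd = inj₁ (inj₂ (inj₂ (inj₂ (inj₂ (inj₂ (inj₂ (inj₂ (p , q , λ { refl → ¬AR cd }))))))))
        adj⇒spec (isX refl) (isZ refl) _ _ cd = ⊥-elim (¬XZ cd)
        adj⇒spec (isX refl) (isA refl) p q _ = inj₁ (inj₂ (inj₂ (inj₂ (inj₂ (inj₂ (inj₁ (p , q)))))))
        adj⇒spec (isX refl) (isX refl) _ _ cd = ⊥-elim (irreflexive cd)
        adj⇒spec (isX refl) (isJ₁ _ _ _) p q _ = inj₁ (inj₂ (inj₂ (inj₂ (inj₁ (p , q)))))
        adj⇒spec (isX refl) (isJ₂ _ _) p q cd = inj₁ (inj₂ (inj₂ (inj₂ (inj₂ (inj₁ (p , q , λ { refl → ¬xy cd }))))))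
        adj⇒spec (isJ₁ _ _ _) (isZ refl) p q _ = inj₂ (inj₂ (inj₂ (inj₁ (q , p))))
        adj⇒spec (isJ₁ _ _ _) (isA refl) p q _ = inj₂ (inj₂ (inj₂ (inj₂ (inj₂ (inj₂ (inj₂ (inj₁ (q , p))))))))
        adj⇒spec (isJ₁ _ _ _) (isX refl) p q _ = inj₂ (inj₂ (inj₂ (inj₂ (inj₁ (q , p)))))
        adj⇒spec (isJ₁ _ _ _) (isJ₁ _ _ _) p q _ = inj₁ (inj₁ (p , q))
        adj⇒spec (isJ₁ c∉S c-side _) (isJ₂ d∉S d-side) _ _ cd = ⊥-elim (apart c∉S d∉S (side-Z≢R c-side d-side) cd)
        adj⇒spec (isJ₂ c∉S c-side) (isZ refl) _ _ cd = ⊥-elim (apart z∉S c∉S (side-Z≢R refl c-side) (symmetric cd))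
        adj⇒spec (isJ₂ _ _) (isA refl) p q cd = inj₂ (inj₂ (inj₂ (inj₂ (inj₂ (inj₂ (inj₂ (inj₂ (q , p , λ { refl → ¬AR (symmetric cd) }))))))))
        adj⇒spec (isJ₂ _ _) (isX refl) p q cd = inj₂ (inj₂ (inj₂ (inj₂ (inj₂ (inj₁ (q , p , λ { refl → ¬xy (symmetric cd) }))))))
        adj⇒spec (isJ₂ c∉S c-side) (isJ₁ d∉S d-side _) _ _ cd = ⊥-elim (apart d∉S c∉S (side-Z≢R d-side c-side) (symmetric cd))
        adj⇒spec (isJ₂ _ _) (isJ₂ _ _) p q _ = inj₁ (inj₂ (inj₁ (p , q)))

        class : Role → Subset n
        class ρ = tabulate (λ c → sameRole (role c) ρ)

        ∈class : ∀ {c ρ} → Kind c ρ → c ∈ class ρ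
        ∈class {c} {ρ} κ = ∈-tabulate⁺ (trans (cong (λ σ → sameRole σ ρ) (role-of κ)) (sameRole-refl ρ))

        class⇒kind : ∀ {c ρ} → c ∈ class ρ → Kind c ρ
        class⇒kind p = kind-of (sameRole-sound (∈-tabulate⁻ p))

        ∣class∣≡1 : ∀ {c ρ} → Kind c ρ → (∀ {d} → Kind d ρ → d ≡ c) → ∣ class ρ ∣ ≡ 1
        ∣class∣≡1 {c} {ρ} κ unique = trans (≤-antisym
          (p⊆q⇒∣p∣≤∣q∣ (λ {d} d∈ → subst (λ v → d ∈ ⁅ v ⁆) (unique (class⇒kind d∈)) (x∈⁅x⁆ d)))
          (p⊆q⇒∣p∣≤∣q∣ (λ {d} d∈ → subst (_∈ class ρ) (sym (x∈⁅y⁆⇒x≡y c d∈)) (∈class κ)))) (∣⁅x⁆∣≡1 c)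

        3≤∣J₁∣ : 3 ≤ ∣ class rJ1 ∣
        3≤∣J₁∣ = ≤-trans (3≤degree Z) (p⊆q⇒∣p∣≤∣q∣ (λ c∈ → nbr (∈-tabulate⁻ c∈) (classify _)))
          where
          nbr : ∀ {c} → Adj G Z c → ∃ (Kind c) → c ∈ class rJ1
          nbr Zc (_ , isZ refl) = ⊥-elim (irreflexive Zc)
          nbr Zc (_ , isA refl) = ⊥-elim (¬AZ (symmetric Zc))
          nbr Zc (_ , isX refl) = ⊥-elim (¬XZ (symmetric Zc))
          nbr Zc (_ , κ@(isJ₁ _ _ _)) = ∈class κ
          nbr Zc (_ , isJ₂ c∉S c-side) = ⊥-elim (apart z∉S c∉S (side-Z≢R refl c-side) Zc)

        R-kind : Kind R rJ2
        R-kind = isJ₂ r∉S refl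

        -- Only one neighbour of `R` lies outside `J₂`, namely `x`; that loss is balanced by `R`
        -- itself, which belongs to `J₂` but is not its own neighbour.
        3≤∣J₂∣ : 3 ≤ ∣ class rJ2 ∣
        3≤∣J₂∣ = ≤-trans (3≤degree R) (≤-trans (p⊆q⇒∣p∣≤∣q∣ (λ c∈ → x∈p∪q⁺ (nbr (∈-tabulate⁻ c∈) (classify _))))
          (≤-trans (∣p∪q∣≤∣p∣+∣q∣ (class rJ2 - R) ⁅ x ⁆)
            (≤-trans (≤-reflexive (trans (cong (∣ class rJ2 - R ∣ +_) (∣⁅x⁆∣≡1 x)) (+-comm _ 1)))
              (x∈p⇒∣p-x∣<∣p∣ (∈class R-kind)))))
          where
          nbr : ∀ {c} → Adj G R c → ∃ (Kind c) → c ∈ class rJ2 - R ⊎ c ∈ ⁅ x ⁆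
          nbr Rc (_ , isZ refl) = ⊥-elim (apart z∉S r∉S z-side (symmetric Rc))
          nbr Rc (_ , isA refl) = ⊥-elim (¬AR (symmetric Rc))
          nbr Rc (_ , isX refl) = inj₂ (x∈⁅x⁆ x)
          nbr Rc (_ , isJ₁ c∉S c-side _) = ⊥-elim (apart c∉S r∉S (side-Z≢R c-side refl) (symmetric Rc))
          nbr Rc (_ , κ@(isJ₂ _ _)) = inj₁ (x∈p∧x≢y⇒x∈p-y (∈class κ) (λ { refl → irreflexive Rc }))

        inG233 : InG233 G
        inG233 = role , y , R , 3≤∣J₁∣ , 3≤∣J₂∣
          , ∣class∣≡1 (isA refl) (λ { (isA eq) → eq })
          , ∣class∣≡1 (isX refl) (λ { (isX eq) → eq })
          , ∣class∣≡1 (isZ refl) (λ { (isZ eq) → eq })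
          , role-of (isJ₂ y∉S y-side) , role-of R-kind , y≢R
          , λ c d c≢d → mk⇔ (adj⇒spec (proj₂ (classify c)) (proj₂ (classify d)) refl refl)
              [ spec⇒adj c≢d , symmetric ∘ spec⇒adj (≢-sym c≢d) ]′

    -- Exclusion of cut vertices

    module CutVertex (∣S∣≡1 : ∣ S ∣ ≡ 1)
      (connected : ∀ u v → WalkIn G (tabulate (λ _ → true)) u v) where

      cut-vertex : ∃ λ s → s ∈ S × (∀ {t} → t ∈ S → t ≡ s)
      cut-vertex with enumerate S 1 (≤-reflexive (sym ∣S∣≡1))
      ... | e , _ , e∈S = e 0F , e∈S 0F , unique
        where
        unique : ∀ {t} → t ∈ S → t ≡ e 0F
        unique {t} t∈S with t ≟ e 0F
        ... | yes eq = eq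
        ... | no t≢s = ⊥-elim (<⇒≱ (x∈p⇒∣p-x∣<∣p∣ (e∈S 0F)) (≤-trans (≤-reflexive ∣S∣≡1)
          (injection⇒≤∣p∣ {1} (S - e 0F) (λ _ → t) (λ { {0F} {0F} _ → refl }) (λ _ → x∈p∧x≢y⇒x∈p-y t∈S t≢s))))

      module WithCutVertex (s : Fin n) (s∈S : s ∈ S) (unique : ∀ {t} → t ∈ S → t ≡ s) where

        S-unique : ∀ {t t'} → t ∈ S → t' ∈ S → t ≡ t'
        S-unique p q = trans (unique p) (sym (unique q))

        -- Each arc has `s` as its tail or its witness. For consecutive arcs this makes `u` and `v`
        -- equal or adjacent, or makes `s` the witness of both: then `s` is adjacent to the tail `v`
        -- of one arc and misses the head `v` of the other.
        no-chain : ∀ {u v w} → u ≢ v → ¬ Adj G u v → Arc G u v → ¬ Arc G v w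
        no-chain {u} {v} u≢v ¬uv (x , X) (y , Y) with u ∈? S | v ∈? S
        ... | yes p | yes q = u≢v (S-unique p q)
        ... | yes p | no q = ¬uv (symmetric (subst (Adj G v) (S-unique (cut Y q) p) (proj₁ Y)))
        ... | no p | yes q = ¬uv (subst (Adj G u) (S-unique (cut X p) q) (proj₁ X))
        ... | no p | no q = proj₁ (proj₂ X) (subst (λ t → Adj G t v) (S-unique (cut Y q) (cut X p)) (symmetric (proj₁ Y)))

        -- However the three pairs are oriented, two of the arcs are consecutive.
        no-triple : ∀ {u v w} → u ≢ v → u ≢ w → v ≢ w → ¬ Adj G u v → ¬ Adj G u w → ¬ Adj G v w → ⊥
        no-triple {u} {v} {w} u≢v u≢w v≢w ¬uv ¬uw ¬vw
          with orient w u≢v ¬uv (≢-sym u≢w) (≢-sym v≢w) ¬uw ¬vw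
             | orient u v≢w ¬vw u≢v u≢w (¬uv ∘ symmetric) (¬uw ∘ symmetric)
             | orient v u≢w ¬uw (≢-sym u≢v) v≢w ¬uv (¬vw ∘ symmetric)
        ... | inj₁ uv | inj₁ vw | _ = no-chain u≢v ¬uv uv vw
        ... | inj₁ _ | inj₂ wv | inj₁ uw = no-chain u≢w ¬uw uw wv
        ... | inj₁ uv | inj₂ _ | inj₂ wu = no-chain (≢-sym u≢w) (¬uw ∘ symmetric) wu uv
        ... | inj₂ vu | _ | inj₁ uw = no-chain (≢-sym u≢v) (¬uv ∘ symmetric) vu uw
        ... | inj₂ _ | inj₁ vw | inj₂ wu = no-chain v≢w ¬vw vw wu
        ... | inj₂ vu | inj₂ wv | inj₂ _ = no-chain (≢-sym v≢w) (¬vw ∘ symmetric) wv vu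

        clique : ∀ {c d} → c ∉ S → d ∉ S → side c ≡ side d → c ≢ d → Adj G c d
        clique {c} {d} c∉S d∉S same c≢d with opposite c
        ... | g , g∉S , g-side = decidable-stable (adj? G c d) λ ¬cd →
          no-triple c≢d (apart-≢ (≢-sym g-side)) (apart-≢ d-side) ¬cd (apart c∉S g∉S (≢-sym g-side)) (apart d∉S g∉S d-side)
          where
          d-side : side d ≢ side g
          d-side eq = g-side (sym (trans same eq))

        attached : ∀ v → v ∉ S → ∃ λ c → c ∉ S × side c ≡ side v × Adj G c s
        attached v v∉S with opposite v
        ... | g , _ , g-side
          with leaving-edge G (λ c → ¬? (c ∈? S) ×-dec (side c ≟ᵇ side v)) (connected v g) (v∉S , refl) (g-side ∘ proj₂)
        ... | c , t , (c∉S , c-side) , ¬Pt , ct with t ∈? S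
        ... | yes t∈S = c , c∉S , c-side , subst (Adj G c) (S-unique t∈S s∈S) ct
        ... | no t∉S = ⊥-elim (¬Pt (t∉S , trans (sym (adj⇒same-side c∉S t∉S ct)) c-side))

        -- Otherwise `s` dominates this side, and a neighbour `c` of `s` on the other side dominates
        -- that side, a clique; so `c` and `s` form a dominating edge.
        misses : ∀ v → ∃ λ h → h ∉ S × side h ≡ side v × ¬ Adj G s h
        misses v with any? (λ h → ¬? (h ∈? S) ×-dec (side h ≟ᵇ side v) ×-dec ¬? (adj? G s h))
        ... | yes found = found
        ... | no none with opposite v
        ... | g , g∉S , g-side with attached g g∉S
        ... | c , c∉S , c-side , cs = ⊥-elim (no-dominating-edge cs dom)
          where
          dom : ∀ t → Dominates G c s t
          dom t with t ∈? S | side t ≟ᵇ side v | t ≟ c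
          ... | yes t∈S | _ | _ = inj₁ (inj₂ (S-unique t∈S s∈S))
          ... | no t∉S | yes t-side | _ = inj₂ (inj₂ (decidable-stable (adj? G s t) (λ ¬st → none (t , t∉S , t-side , ¬st))))
          ... | no _ | no _ | yes t≡c = inj₁ (inj₁ t≡c)
          ... | no t∉S | no d | no t≢c = inj₂ (inj₁ (clique c∉S t∉S
            (trans c-side (trans (¬-not g-side) (sym (¬-not d)))) (≢-sym t≢c)))

        contradictory : ⊥
        contradictory with opposite s
        ... | v , v∉S , _ with opposite v
        ... | w , w∉S , w-side with misses v | misses w
        ... | h , h∉S , h-side , ¬sh | c , c∉S , c-side , ¬sc =
          no-triple (λ { refl → h∉S s∈S }) (λ { refl → c∉S s∈S }) (apart-≢ d) ¬sh ¬sc (apart h∉S c∉S d)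
          where
          d : side h ≢ side c
          d eq = w-side (trans (sym c-side) (trans (sym eq) h-side))

      impossible : ⊥
      impossible with cut-vertex
      ... | s , s∈S , unique = WithCutVertex.contradictory s s∈S unique

-- From the definition of criticality to arcs

EdgeWith : ∀ {n} → Graph n → Fin n → Fin n → Fin n → Fin n → Set
EdgeWith G u v x y = Adj G x y ⊎ ((x ≡ u × y ≡ v) ⊎ (x ≡ v × y ≡ u))

addEdge⁻ : ∀ {n} (G : Graph n) {u v x y} → Adj (addEdge G u v) x y → EdgeWith G u v x y
addEdge⁻ G {u} {v} {x} {y} e with G x y | x ≟ u | y ≟ v | x ≟ v | y ≟ u
... | true | _ | _ | _ | _ = inj₁ refl
... | false | yes p | yes q | _ | _ = inj₂ (inj₁ (p , q))
... | false | yes _ | no _ | yes p | yes q = inj₂ (inj₂ (p , q))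
... | false | no _ | _ | yes p | yes q = inj₂ (inj₂ (p , q))

two-members : ∀ {n} (D : Subset n) → ∣ D ∣ ≤ 2 → ∀ {x} → x ∈ D → ∃ λ y → y ∈ D × (∀ {t} → t ∈ D → t ≡ x ⊎ t ≡ y)
two-members D ∣D∣≤2 {x} x∈D with any? (λ y → (y ∈? D) ×-dec ¬? (y ≟ x))
... | no none = x , x∈D , λ {t} t∈D → inj₁ (decidable-stable (t ≟ x) (λ t≢x → none (t , t∈D , t≢x)))
... | yes (y , y∈D , y≢x) = y , y∈D , λ {t} t∈D → member t∈D (t ≟ x) (t ≟ y)
  where
  member : ∀ {t} → t ∈ D → Dec (t ≡ x) → Dec (t ≡ y) → t ≡ x ⊎ t ≡ y
  member t∈D (yes eq) _ = inj₁ eq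
  member t∈D (no _) (yes eq) = inj₂ eq
  member {t} t∈D (no t≢x) (no t≢y) = ⊥-elim (<⇒≱ (s≤s ∣D∣≤2)
    (injection⇒≤∣p∣ D (triple t x y) (triple-injective t≢x t≢y (≢-sym y≢x)) (λ { 0F → t∈D ; 1F → x∈D ; 2F → y∈D })))

module Criticality {n} (G : Graph n) (simple : IsSimple G)
  (connected : ∀ u v → WalkIn G (tabulate (λ _ → true)) u v) (γ≡3 : GammaC G 3) where

  symmetric : ∀ {x y} → Adj G x y → Adj G y x
  symmetric {x} {y} xy = trans (proj₁ simple y x) xy

  irreflexive : ∀ {x} → ¬ Adj G x x
  irreflexive {x} xx = case trans (sym xx) (proj₂ simple x) of λ ()

  no-dominating-pair : ∀ {u w} → u ≡ w ⊎ Adj G u w → ¬ (∀ y → Dominates G u w y)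
  no-dominating-pair {u} {w} uw dom = <⇒≱ (s≤s (∣⁅x⁆∪⁅y⁆∣≤2 u w)) (proj₂ γ≡3 D (dominating , induced))
    where
    D = ⁅ u ⁆ ∪ ⁅ w ⁆
    u∈D : u ∈ D
    u∈D = x∈p∪q⁺ (inj₁ (x∈⁅x⁆ u))
    w∈D : w ∈ D
    w∈D = x∈p∪q⁺ {p = ⁅ u ⁆} (inj₂ (x∈⁅x⁆ w))
    dominating : Dominating G D
    dominating y with dom y
    ... | inj₁ (inj₁ refl) = inj₁ u∈D
    ... | inj₁ (inj₂ refl) = inj₁ w∈D
    ... | inj₂ (inj₁ uy) = inj₂ (u , u∈D , uy)
    ... | inj₂ (inj₂ wy) = inj₂ (w , w∈D , wy)
    D⁻ : ∀ {x} → x ∈ D → x ≡ u ⊎ x ≡ w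
    D⁻ x∈D = Sum.map (x∈⁅y⁆⇒x≡y u) (x∈⁅y⁆⇒x≡y w) (x∈p∪q⁻ ⁅ u ⁆ ⁅ w ⁆ x∈D)
    walk : u ≡ w ⊎ Adj G u w → WalkIn G D u w × WalkIn G D w u
    walk (inj₁ refl) = here , here
    walk (inj₂ e) = step e w∈D here , step (symmetric e) u∈D here
    induced : InducedConnected G D
    induced x y x∈D y∈D with D⁻ x∈D | D⁻ y∈D
    ... | inj₁ refl | inj₁ refl = here
    ... | inj₁ refl | inj₂ refl = proj₁ (walk uw)
    ... | inj₂ refl | inj₁ refl = proj₂ (walk uw)
    ... | inj₂ refl | inj₂ refl = here

  neighbour : ∀ {u v} → u ≢ v → ∃ (Adj G v)
  neighbour {u} {v} u≢v with leaving-edge G (_≟ v) (connected v u) refl u≢v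
  ... | _ , t , refl , _ , vt = t , vt

  -- For `y` equal to `v` the first alternative holds. If `y` is `u`, then `u` together with a
  -- neighbour of `v` is a dominating edge of `G`. Any other `y` is a witness, since adjacency to
  -- `v` would make `u` and `y` dominate `G`.
  dominating-endpoint : ∀ {u v y} → u ≢ v → ¬ Adj G u v → u ≡ y ⊎ EdgeWith G u v u y →
    (∀ t → (t ≡ u ⊎ t ≡ y) ⊎ (EdgeWith G u v u t ⊎ EdgeWith G u v y t)) →
    (∀ t → Dominates G u v t) ⊎ Arc G u v
  dominating-endpoint {u} {v} {y} u≢v ¬uv uy dom with y ≟ v | y ≟ u
  ... | yes refl | _ = inj₁ λ t → case dom t of λ
    { (inj₁ eq) → inj₁ eq
    ; (inj₂ (inj₁ (inj₁ ut))) → inj₂ (inj₁ ut)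
    ; (inj₂ (inj₁ (inj₂ (inj₁ (_ , t≡v))))) → inj₁ (inj₂ t≡v)
    ; (inj₂ (inj₁ (inj₂ (inj₂ (u≡v , _))))) → ⊥-elim (u≢v u≡v)
    ; (inj₂ (inj₂ (inj₁ vt))) → inj₂ (inj₂ vt)
    ; (inj₂ (inj₂ (inj₂ (inj₁ (v≡u , _))))) → ⊥-elim (u≢v (sym v≡u))
    ; (inj₂ (inj₂ (inj₂ (inj₂ (_ , t≡u))))) → inj₁ (inj₁ t≡u) }
  ... | no _ | yes refl with neighbour u≢v
  ... | s , vs = ⊥-elim (no-dominating-pair (inj₂ us) dom-us)
    where
    u-dominates : ∀ t → t ≡ u ⊎ (Adj G u t ⊎ t ≡ v)
    u-dominates t with dom t
    ... | inj₁ (inj₁ eq) = inj₁ eq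
    ... | inj₁ (inj₂ eq) = inj₁ eq
    ... | inj₂ (inj₁ (inj₁ ut)) = inj₂ (inj₁ ut)
    ... | inj₂ (inj₁ (inj₂ (inj₁ (_ , t≡v)))) = inj₂ (inj₂ t≡v)
    ... | inj₂ (inj₁ (inj₂ (inj₂ (_ , t≡u)))) = inj₁ t≡u
    ... | inj₂ (inj₂ (inj₁ ut)) = inj₂ (inj₁ ut)
    ... | inj₂ (inj₂ (inj₂ (inj₁ (_ , t≡v)))) = inj₂ (inj₂ t≡v)
    ... | inj₂ (inj₂ (inj₂ (inj₂ (_ , t≡u)))) = inj₁ t≡u
    us : Adj G u s
    us with u-dominates s
    ... | inj₁ refl = ⊥-elim (¬uv (symmetric vs))
    ... | inj₂ (inj₁ us) = us
    ... | inj₂ (inj₂ refl) = ⊥-elim (irreflexive vs)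
    dom-us : ∀ t → Dominates G u s t
    dom-us t with u-dominates t
    ... | inj₁ eq = inj₁ (inj₁ eq)
    ... | inj₂ (inj₁ ut) = inj₂ (inj₁ ut)
    ... | inj₂ (inj₂ refl) = inj₂ (inj₂ (symmetric vs))
  dominating-endpoint {u} {v} {y} u≢v ¬uv uy dom | no y≢v | no y≢u = conclude (adj? G y v)
    where
    u~y : u ≡ y ⊎ EdgeWith G u v u y → Adj G u y
    u~y (inj₁ eq) = ⊥-elim (y≢u (sym eq))
    u~y (inj₂ (inj₁ e)) = e
    u~y (inj₂ (inj₂ (inj₁ (_ , y≡v)))) = ⊥-elim (y≢v y≡v)
    u~y (inj₂ (inj₂ (inj₂ (_ , y≡u)))) = ⊥-elim (y≢u y≡u)
    dom-uy : ∀ t → t ≢ v → Dominates G u y t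
    dom-uy t t≢v with dom t
    ... | inj₁ eq = inj₁ eq
    ... | inj₂ (inj₁ (inj₁ ut)) = inj₂ (inj₁ ut)
    ... | inj₂ (inj₁ (inj₂ (inj₁ (_ , t≡v)))) = ⊥-elim (t≢v t≡v)
    ... | inj₂ (inj₁ (inj₂ (inj₂ (u≡v , _)))) = ⊥-elim (u≢v u≡v)
    ... | inj₂ (inj₂ (inj₁ yt)) = inj₂ (inj₂ yt)
    ... | inj₂ (inj₂ (inj₂ (inj₁ (y≡u , _)))) = ⊥-elim (y≢u y≡u)
    ... | inj₂ (inj₂ (inj₂ (inj₂ (y≡v , _)))) = ⊥-elim (y≢v y≡v)
    conclude : Dec (Adj G y v) → (∀ t → Dominates G u v t) ⊎ Arc G u v
    conclude (no ¬yv) = inj₂ (y , u~y uy , ¬yv , dom-uy)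
    conclude (yes yv) = ⊥-elim (no-dominating-pair (inj₂ (u~y uy)) dom-all)
      where
      dom-all : ∀ t → Dominates G u y t
      dom-all t with t ≟ v
      ... | yes refl = inj₂ (inj₂ yv)
      ... | no t≢v = dom-uy t t≢v

  EdgeWith-sym : ∀ {u v x y} → EdgeWith G u v x y → EdgeWith G u v y x
  EdgeWith-sym (inj₁ e) = inj₁ (symmetric e)
  EdgeWith-sym (inj₂ (inj₁ (p , q))) = inj₂ (inj₂ (q , p))
  EdgeWith-sym (inj₂ (inj₂ (p , q))) = inj₂ (inj₁ (q , p))

  EdgeWith-swap : ∀ {u v x y} → EdgeWith G u v x y → EdgeWith G v u x y
  EdgeWith-swap = Sum.map₂ Sum.swap

  EdgeWith-proper : ∀ {u v x y} → x ≢ u → x ≢ v → EdgeWith G u v x y → Adj G x y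
  EdgeWith-proper x≢u x≢v (inj₁ e) = e
  EdgeWith-proper x≢u x≢v (inj₂ (inj₁ (x≡u , _))) = ⊥-elim (x≢u x≡u)
  EdgeWith-proper x≢u x≢v (inj₂ (inj₂ (x≡v , _))) = ⊥-elim (x≢v x≡v)

  DominatesWith : Fin n → Fin n → Fin n → Fin n → Set
  DominatesWith u v x y = (x ≡ y ⊎ EdgeWith G u v x y) ×
    (∀ t → (t ≡ x ⊎ t ≡ y) ⊎ (EdgeWith G u v x t ⊎ EdgeWith G u v y t))

  -- A pair avoiding both `u` and `v` gains nothing from the new edge and would already dominate
  -- `G`.
  dominating-pair⇒arc : ∀ {u v x y} → u ≢ v → ¬ Adj G u v → DominatesWith u v x y →
    (∀ t → Dominates G u v t) ⊎ (Arc G u v ⊎ Arc G v u)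
  dominating-pair⇒arc {u} {v} {x} {y} u≢v ¬uv (xy , dom) with x ≟ u | x ≟ v | y ≟ u | y ≟ v
  ... | yes refl | _ | _ | _ = Sum.map₂ inj₁ (dominating-endpoint u≢v ¬uv xy dom)
  ... | no _ | yes refl | _ | _ = Sum.map (λ d t → Sum.map Sum.swap Sum.swap (d t)) inj₂
    (dominating-endpoint (≢-sym u≢v) (¬uv ∘ symmetric) (Sum.map₂ EdgeWith-swap xy)
      (λ t → Sum.map₂ (Sum.map EdgeWith-swap EdgeWith-swap) (dom t)))
  ... | no _ | no _ | yes refl | _ = Sum.map₂ inj₁
    (dominating-endpoint u≢v ¬uv (Sum.map sym EdgeWith-sym xy) (λ t → Sum.map Sum.swap Sum.swap (dom t)))
  ... | no _ | no _ | no _ | yes refl = Sum.map (λ d t → Sum.map Sum.swap Sum.swap (d t)) inj₂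
    (dominating-endpoint (≢-sym u≢v) (¬uv ∘ symmetric) (Sum.map sym (EdgeWith-swap ∘ EdgeWith-sym) xy)
      (λ t → Sum.map Sum.swap (Sum.swap ∘ Sum.map EdgeWith-swap EdgeWith-swap) (dom t)))
  ... | no x≢u | no x≢v | no y≢u | no y≢v = ⊥-elim (no-dominating-pair
    (Sum.map₂ (EdgeWith-proper x≢u x≢v) xy)
    (λ t → Sum.map₂ (Sum.map (EdgeWith-proper x≢u x≢v) (EdgeWith-proper y≢u y≢v)) (dom t)))

  dominating-pair : ∀ {u v k} → u ≢ v → k < 3 → GammaC (addEdge G u v) k → ∃ λ x → ∃ λ y → DominatesWith u v x y
  dominating-pair {u} {v} {k} u≢v k<3 ((D , (dom , conn) , ∣D∣≡k) , _) = found member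
    where
    ∣D∣≤2 : ∣ D ∣ ≤ 2
    ∣D∣≤2 = ≤-trans (≤-reflexive ∣D∣≡k) (s≤s⁻¹ k<3)
    member : ∃ (_∈ D)
    member with dom u
    ... | inj₁ u∈D = u , u∈D
    ... | inj₂ (w , w∈D , _) = w , w∈D
    found : ∃ (_∈ D) → ∃ λ x → ∃ λ y → DominatesWith u v x y
    found (x , x∈D) with two-members D ∣D∣≤2 x∈D
    ... | y , y∈D , members = x , y , joined (conn x y x∈D y∈D) , dom'
      where
      joined : WalkIn (addEdge G u v) D x y → x ≡ y ⊎ EdgeWith G u v x y
      joined here = inj₁ refl
      -- The first step already ends at `y`, because it stays in `D` and there is no loop at `x`.
      joined (step e t∈D _) with members t∈D | addEdge⁻ G e
      ... | inj₂ refl | e' = inj₂ e'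
      ... | inj₁ refl | inj₁ xx = ⊥-elim (irreflexive xx)
      ... | inj₁ refl | inj₂ (inj₁ (p , q)) = ⊥-elim (u≢v (trans (sym p) q))
      ... | inj₁ refl | inj₂ (inj₂ (p , q)) = ⊥-elim (u≢v (trans (sym q) p))
      dom' : ∀ t → (t ≡ x ⊎ t ≡ y) ⊎ (EdgeWith G u v x t ⊎ EdgeWith G u v y t)
      dom' t with dom t
      ... | inj₁ t∈D = inj₁ (members t∈D)
      ... | inj₂ (w , w∈D , e) with members w∈D
      ... | inj₁ refl = inj₂ (inj₁ (addEdge⁻ G e))
      ... | inj₂ refl = inj₂ (inj₂ (addEdge⁻ G e))

  -- Connectivity and minimum degree

  non-neighbour : ∀ v → ∃ λ u → u ≢ v × ¬ Adj G v u
  non-neighbour v with any? (λ u → ¬? (u ≟ v) ×-dec ¬? (adj? G v u))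
  ... | yes found = found
  ... | no none = ⊥-elim (no-dominating-pair (inj₁ refl) dom)
    where
    dom : ∀ t → Dominates G v v t
    dom t with t ≟ v
    ... | yes eq = inj₁ (inj₁ eq)
    ... | no t≢v = inj₂ (inj₁ (decidable-stable (adj? G v t) (λ ¬vt → none (t , t≢v , ¬vt))))

  neighbourhood-separates : ∀ v → Separating G (tabulate (G v))
  neighbourhood-separates v with non-neighbour v
  ... | u , u≢v , ¬vu = v , u , irreflexive ∘ ∈-tabulate⁻ , ¬vu ∘ ∈-tabulate⁻ , no-walk
    where
    no-walk : ¬ WalkIn G (∁ (tabulate (G v))) v u
    no-walk here = u≢v refl
    no-walk (step vt t∉N _) = x∈∁p⇒x∉p t∉N (∈-tabulate⁺ vt)

  -- Every neighbourhood separates its vertex from some non-neighbour, which also voids the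
  -- complete-graph clause of `Kappa`.
  κ≤degree : ∀ {k} → Kappa G k → ∀ v → k ≤ degree G v
  κ≤degree (inj₁ (_ , minimum)) v = minimum _ (neighbourhood-separates v)
  κ≤degree (inj₂ (none , _)) v = ⊥-elim (none _ (neighbourhood-separates v))

  minimum-separator : ∀ {k} → Kappa G k → Fin n → ∃ λ S → Separating G S × ∣ S ∣ ≡ k
  minimum-separator (inj₁ (found , _)) _ = found
  minimum-separator (inj₂ (none , _)) v = ⊥-elim (none _ (neighbourhood-separates v))

isCritical : ∀ {n} (G : Graph n) → IsSimple G → Connected G → Critical3 G → IsCritical G
isCritical G simple (_ , connected) (γ≡3 , critical) = record
  { symmetric = symmetric
  ; irreflexive = irreflexive
  ; no-dominating-edge = no-dominating-pair ∘ inj₂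
  ; critical = λ u v u≢v ¬uv → case critical u v u≢v (¬-not ¬uv) of λ
      (k , k<3 , γ) → dominating-pair⇒arc u≢v ¬uv (proj₂ (proj₂ (dominating-pair u≢v k<3 γ))) }
  where open Criticality G simple connected γ≡3

-- From a minimum cut to the equality of κ and δ

snoc : ∀ {n} {G : Graph n} {T u v w} → WalkIn G T u v → Adj G v w → w ∈ T → WalkIn G T u w
snoc here vw w∈T = step vw w∈T here
snoc (step e t∈T walk) vw w∈T = step e t∈T (snoc walk vw w∈T)

¬¬-∀ : ∀ {n} {P : Fin n → Set} → (∀ i → ¬ ¬ P i) → ¬ ¬ (∀ i → P i)
¬¬-∀ {zero} _ k = k λ ()
¬¬-∀ {suc n} ps k = ps zero λ p → ¬¬-∀ (ps ∘ suc) λ ps' → k λ { zero → p ; (suc i) → ps' i }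

-- One side is the set of vertices reachable from `u` outside `S`. Reachability is not decided;
-- excluded middle is taken under double negation at finitely many vertices, which suffices for
-- deriving `⊥`.
separation : ∀ {n} {G : Graph n} → (∀ {x y} → Adj G x y → Adj G y x) → ∀ {S} → Separating G S →
  ¬ ¬ ∃ (IsSeparation G S)
separation {n} {G} symmetric {S} (u , v , u∉S , v∉S , ¬walk) k = ¬¬-∀ (λ x → ¬¬-excluded-middle) λ reach? →
  k (sides reach?)
  where
  sides : (∀ x → Dec (WalkIn G (∁ S) u x)) → ∃ (IsSeparation G S)
  sides reach? = side , record
    { adj⇒same-side = λ {x} {y} x∉S y∉S xy → does-⇔
        (mk⇔ (λ walk → snoc walk xy (x∉p⇒x∈∁p y∉S)) (λ walk → snoc walk (symmetric xy) (x∉p⇒x∈∁p x∉S)))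
        (reach? x) (reach? y)
    ; opposite = opposite }
    where
    side : Fin n → Bool
    side x = does (reach? x)
    side-u : side u ≡ true
    side-u = dec-true (reach? u) here
    side-v : side v ≡ false
    side-v = dec-false (reach? v) ¬walk
    opposite : ∀ x → ∃ λ y → y ∉ S × side y ≢ side x
    opposite x with side x
    ... | true = v , v∉S , λ eq → case trans (sym eq) side-v of λ ()
    ... | false = u , u∉S , λ eq → case trans (sym eq) side-u of λ ()

every-cut-nonempty : ∀ {n} (G : Graph n) → Connected G → ∀ {S} → Separating G S → ∣ S ∣ ≢ 0
every-cut-nonempty G (_ , connected) {S} (u , v , _ , _ , ¬walk) ∣S∣≡0 = ¬walk (restrict (connected u v))
  where
  restrict : ∀ {x y} → WalkIn G (tabulate (λ _ → true)) x y → WalkIn G (∁ S) x y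
  restrict here = here
  restrict (step e _ walk) = step e (x∉p⇒x∈∁p S-empty) (restrict walk)
    where
    S-empty : ∀ {t} → t ∉ S
    S-empty t∈S = case ≤-trans (x∈p⇒∣p-x∣<∣p∣ t∈S) (≤-reflexive ∣S∣≡0) of λ ()

κ<δ∧κ<α⇒InG233 : ∀ {n} (G : Graph n) → IsSimple G → Connected G → Critical3 G →
  ∀ {a k d} → Alpha G a → Kappa G k → Delta G d → k < d → k < a → ¬ ¬ InG233 G
κ<δ∧κ<α⇒InG233 {n} G simple conn crit {a} {k} {d} ((T , T-indep , ∣T∣≡a) , _) κ≡k (_ , d-min) k<d k<a ¬exceptional =
  from-separator (Criticality.minimum-separator G simple (proj₂ conn) (proj₁ crit) κ≡k (some-vertex (proj₁ conn)))
  where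
  some-vertex : ∀ {m} → 1 ≤ m → Fin m
  some-vertex (s≤s _) = zero
  critical = isCritical G simple conn crit
  open IsCritical critical using (symmetric; irreflexive)
  from-separator : (∃ λ S → Separating G S × ∣ S ∣ ≡ k) → ⊥
  from-separator (S , sep , ∣S∣≡k) = separation symmetric sep λ (side , isSep) → by-size side isSep k refl
    where
    exit : ∀ x → ∃ λ y → Adj G x y × y ∉ S
    exit x with any? (λ y → adj? G x y ×-dec ¬? (y ∈? S))
    ... | yes found = found
    ... | no none = ⊥-elim (<⇒≱ k<d (≤-trans (d-min x) (≤-trans (p⊆q⇒∣p∣≤∣q∣ N⊆S) (≤-reflexive ∣S∣≡k))))
      where
      N⊆S : tabulate (G x) ⊆ S
      N⊆S {y} y∈N = decidable-stable (y ∈? S) (λ y∉S → none (y , ∈-tabulate⁻ y∈N , y∉S))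
    by-size : ∀ side → IsSeparation G S side → ∀ j → k ≡ j → ⊥
    by-size side isSep 0 refl = every-cut-nonempty G conn sep ∣S∣≡k
    by-size side isSep 1 refl = impossible
      where open Critical.Separated.CutVertex G critical S side isSep exit ∣S∣≡k (proj₂ conn)
    by-size side isSep (suc (suc j)) refl with enumerate T (suc k) (≤-trans k<a (≤-reflexive (sym ∣T∣≡a)))
    ... | e , inj , e∈T = two (exceptional⇒m≡2 (s≤s (s≤s z≤n)) exc) e independent exc
      where
      open Critical G critical using (IndependentFamily)
      open Critical.Separated G critical S side isSep exit
      independent : IndependentFamily e
      independent = inj , λ i i' adj → case trans (sym adj) (T-indep _ _ (e∈T i) (e∈T i')) of λ ()
      exc : Exceptional e
      exc = exceptional (s≤s (s≤s z≤n)) ∣S∣≡k e independent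
      two : k ≡ 2 → (e : Fin (suc k) → Fin n) → IndependentFamily e → Exceptional e → ⊥
      two refl e independent exc = ¬exceptional (inG233 classify)
        where open TwoElementCut ∣S∣≡k e independent exc (λ v → ≤-trans k<d (d-min v)); open Roles

theorem3p8 : ∀ (n : ℕ) (G : Graph n) → IsSimple G → Connected G → Critical3 G → ¬ InG233 G →
    ∀ (a k d : ℕ) → Alpha G a → Kappa G k → Delta G d →
    ∀ (q : ℕ) → (q ≡ 1 ⊎ q ≡ 2) → (a ≡ k + q ⇔ a ≡ d + q)
theorem3p8 n G simple conn crit ¬exceptional a k d α κ δ q q≡1∨2 = mk⇔
  -- Both directions need `k < a`: here it is immediate from `a ≡ k + q`, in the converse it comes
  -- from `k ≤ d` and `a ≡ d + q`.
  (λ a≡k+q → trans a≡k+q (cong (_+ q) (k≡d (<-≤-trans k<k+q (≤-reflexive (sym a≡k+q))))))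
  (λ a≡d+q → trans a≡d+q (cong (_+ q) (sym (k≡d (<-≤-trans k<k+q
    (≤-trans (+-monoˡ-≤ q k≤d) (≤-reflexive (sym a≡d+q))))))))
  where
  0<q : 0 < q
  0<q = [ (λ { refl → s≤s z≤n }) , (λ { refl → s≤s z≤n }) ]′ q≡1∨2
  k<k+q : k < k + q
  k<k+q = m<m+n k 0<q
  k≤d : k ≤ d
  k≤d with proj₁ δ
  ... | v , degree≡d = ≤-trans (Criticality.κ≤degree G simple (proj₂ conn) (proj₁ crit) κ v) (≤-reflexive degree≡d)
  k≡d : k < a → k ≡ d
  k≡d k<a with m≤n⇒m<n∨m≡n k≤d
  ... | inj₁ k<d = ⊥-elim (κ<δ∧κ<α⇒InG233 G simple conn crit α κ δ k<d k<a ¬exceptional)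
  ... | inj₂ eq = eq
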